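{- Let $L$ be a nonnegative integer. For nonnegative integers $n_1,n_2,n_3$ put $N_1=n_1+n_2+n_3$, $N_2=n_2+n_3$, $N_3=n_3$. Then \[ A_L(q)=\sum_{\substack{n_1,n_2,n_3\ge 0\\ N_1+N_2+N_3\le L}}\frac{q^{N_1^2+N_2^2+N_3^2}(q;q)_{L-N_1}(q;q)_{2L-N_1-N_2}}{(q;q)_{2L-2N_1}(q;q)_{L-N_1-N_2-N_3}(q;q)_{n_1}(q;q)_{n_2}(q;q)_{n_3}}. \]
   Context: $(a;q)_n=\prod_{i=0}^{n-1}(1-aq^i)$. The Borwein polynomials $A_n,B_n,C_n$ are the unique polynomials in $q$ such that $A_n(q^3)-qB_n(q^3)-q^2C_n(q^3)=(q;q^3)_n(q^2;q^3)_n$; i.e. $A_n(q^3)$ collects the terms of $(q;q^3)_n(q^2;q^3)_n$ whose exponent is divisible by $3$. -}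

module Defs where

open import Data.Nat as ℕ using (ℕ; zero; suc; _∸_; _≤?_; _≟_)
open import Data.Nat.Divisibility using (_∣?_)
open import Data.Integer using (ℤ; 0ℤ; 1ℤ; _+_; _*_; -_)
open import Relation.Nullary.Decidable using (does)
open import Data.Bool using (if_then_else_)

-- Formal power series over ℤ in the variable q, as coefficient functions.
-- (Polynomials are the finitely supported ones.)
Series : Set
Series = ℕ → ℤ

sumTo : ℕ → (ℕ → ℤ) → ℤ
sumTo zero    h = h 0
sumTo (suc n) h = sumTo n h + h (suc n)

zeroS : Series
zeroS _ = 0ℤ

oneS : Series
oneS zero    = 1ℤ
oneS (suc _) = 0ℤ

qpow : ℕ → Series
qpow m n = if does (n ≟ m) then 1ℤ else 0ℤ

_⊕_ : Series → Series → Series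
(f ⊕ g) n = f n + g n

_⊖_ : Series → Series → Series
(f ⊖ g) n = f n + - g n

_⊗_ : Series → Series → Series
(f ⊗ g) n = sumTo n (λ k → f k * g (n ∸ k))

infixl 6 _⊕_ _⊖_
infixl 7 _⊗_

qPoch : ℕ → ℕ → ℕ → Series
qPoch a d zero    = oneS
qPoch a d (suc n) = qPoch a d n ⊗ (oneS ⊖ qpow (a ℕ.+ d ℕ.* n))

qfac : ℕ → Series
qfac n = qPoch 1 1 n

-- 1/(1 - q^(suc j)) = Σ_m q^((suc j) m) in ℤ[[q]]
geomInv : ℕ → Series
geomInv j n = if does (suc j ∣? n) then 1ℤ else 0ℤ

qfacInv : ℕ → Series
qfacInv zero    = oneS
qfacInv (suc n) = qfacInv n ⊗ geomInv n

-- Borwein polynomial A_n: A_n(q^3) is the part of (q;q^3)_n (q^2;q^3)_n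
-- with exponents divisible by 3, so coeff_k A_n = coeff_{3k} of that product.
BorweinA : ℕ → Series
BorweinA n k = (qPoch 1 3 n ⊗ qPoch 2 3 n) (3 ℕ.* k)

sumS : ℕ → (ℕ → Series) → Series
sumS zero    F = F 0
sumS (suc n) F = sumS n F ⊕ F (suc n)

-- The summand for (n₁,n₂,n₃) of the right-hand side (zero outside the range
-- N₁+N₂+N₃ ≤ L; inside that range all truncated subtractions are genuine).
summand : ℕ → ℕ → ℕ → ℕ → Series
summand L n₁ n₂ n₃ =
  if does (N₁ ℕ.+ N₂ ℕ.+ N₃ ≤? L)
  then qpow (N₁ ℕ.* N₁ ℕ.+ N₂ ℕ.* N₂ ℕ.+ N₃ ℕ.* N₃)
       ⊗ qfac (L ∸ N₁) ⊗ qfac (2 ℕ.* L ∸ N₁ ∸ N₂)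
       ⊗ qfacInv (2 ℕ.* L ∸ 2 ℕ.* N₁) ⊗ qfacInv (L ∸ N₁ ∸ N₂ ∸ N₃)
       ⊗ qfacInv n₁ ⊗ qfacInv n₂ ⊗ qfacInv n₃
  else zeroS
  where
    N₁ = n₁ ℕ.+ n₂ ℕ.+ n₃
    N₂ = n₂ ℕ.+ n₃
    N₃ = n₃

-- The right-hand side: sum over n₁,n₂,n₃ ≥ 0 with N₁+N₂+N₃ ≤ L
-- (each nᵢ ≤ L is then automatic, so summing nᵢ over 0..L loses nothing).
rhs : ℕ → Series
rhs L = sumS L λ n₁ → sumS L λ n₂ → sumS L λ n₃ → summand L n₁ n₂ n₃

{-# OPTIONS --safe #-}

-- Write K(n,l) = 1/((q;q)_(n-l) (q;q)_(n+l)). By the q-binomial theorem and q-Vandermonde,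
-- (q;q³)_L (q²;q³)_L expands in the q³-binomial coefficients [2L, L+j]; only the terms with
-- 3 | j contribute to A_L, whence
--   A_L = Σ_l α_l q^(4l²) (q;q)_2L K(L,3l),  α_0 = 1,  α_l = (-1)^l q^(l(l-1)/2) (1 + q^l),
-- where α is the sequence inverting K, i.e. Σ_l α_l K(n,l) = δ_(n,0).
-- The right-hand side produces the same sum: each of four summations against K contributes
-- a factor q^(l²). Summing against δ gives 1/(q;q)_(N₃) = Σ_l α_l q^(l²) K(N₃,l); the sums
-- over N₃ and N₁ are then q-Vandermonde sums, and the sum over N₂ is a balanced q-Saalschütz sum.
module Submission where

open import Defs
open import Algebra using (CommutativeRing)
import Algebra.Properties.Ring
import Algebra.Properties.Semiring.Mult.TCOptimised
import Algebra.Solver.Ring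
open import Algebra.Solver.Ring.AlmostCommutativeRing using (fromCommutativeRing; _-Raw-AlmostCommutative⟶_)
open import Data.Bool using (if_then_else_)
open import Data.Integer as ℤ using (ℤ; +_; -[1+_]; 0ℤ; 1ℤ)
import Data.Integer.Properties as ℤ
open import Data.Integer.Tactic.RingSolver using () renaming (solve-∀ to solveℤ)
open import Data.Maybe using (map)
open import Data.Nat as ℕ using (ℕ; zero; suc; _∸_; _≤_; _<_; z≤n; s≤s; z<s; s<s; _≤?_) renaming (_+_ to _∔_; _*_ to _∙_)
open import Data.Nat.Divisibility using (_∣?_; ∣m∣n⇒∣m+n; ∣m+n∣m⇒∣n; ∣-refl; _∣0; >⇒∤)
import Data.Nat.Properties as ℕ
open import Data.Nat.Tactic.RingSolver using () renaming (solve-∀ to solveℕ)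
open import Data.Product using (∃; ∃₂; _×_; _,_)
open import Data.Sum using (_⊎_; inj₁; inj₂)
open import Function using (_∘_; mk⇔)
open import Level using (_⊔_)
open import Relation.Binary.PropositionalEquality as ≡ using (_≡_; _≗_; cong; cong₂)
open import Relation.Nullary using (Dec; yes; no; ¬_)
open import Relation.Nullary.Decidable using (does; does-⇔; dec-true; dec-false; dec⇒maybe)

-- The two sides reach the exponent 4l² for different reasons: on the Borwein side 3l(3l-1)/2 + l =
-- l(l-1)/2 + 4l², on the other side completing a square in each of the four kernel sums. The index
-- 3l also arises gradually. With D = L - N₁ and up to q-factorials, the sum over N₃ yields K(N₂,l)
-- K(D-N₂,l), the sum over N₂ yields K(N₁,l) K(D,2l), and the sum over N₁ joins the two kernels into
-- K(L,3l). The obstacle is that the kernel changes shape from step to step, so that one form of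
-- Bailey's lemma cannot simply be iterated; what the steps share is a single WZ recurrence.
-- Two-sided sums are folded to l ≥ 0. Reciprocals 1/(q;q)_(a-m) are total, with value 0 for m > a,
-- so that sums can run over one fixed range and be interchanged freely. The q-series algebra takes
-- place in an abstract commutative ring with powers of q, where a ring solver settles the
-- polynomial identities.

-- The ring of formal power series over ℤ

module SeriesRing where
  open import Data.Integer using (_+_; _*_; -_)
  open ≡ using (refl; sym; trans; module ≡-Reasoning)

  tail : Series → Series
  tail f n = f (suc n)

  infixr 8 _·_
  _·_ : ℤ → Series → Series
  (c · f) n = c * f n

  negS : Series → Series
  negS f n = - f n

  sumTo-cong : ∀ n {f g : ℕ → ℤ} → f ≗ g → sumTo n f ≡ sumTo n g
  sumTo-cong zero    e = e 0
  sumTo-cong (suc n) e = cong₂ _+_ (sumTo-cong n e) (e (suc n))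

  sumTo-head : ∀ n h → sumTo (suc n) h ≡ h 0 + sumTo n (h ∘ suc)
  sumTo-head zero    h = refl
  sumTo-head (suc n) h = trans (cong (_+ h (suc (suc n))) (sumTo-head n h)) (ℤ.+-assoc (h 0) _ _)

  ⊗-suc : ∀ f g n → (f ⊗ g) (suc n) ≡ f 0 * g (suc n) + (tail f ⊗ g) n
  ⊗-suc f g n = sumTo-head n (λ k → f k * g (suc n ∸ k))

  ⊗-cong : ∀ {f f′ g g′} → f ≗ f′ → g ≗ g′ → f ⊗ g ≗ f′ ⊗ g′
  ⊗-cong e e′ n = sumTo-cong n (λ k → cong₂ _*_ (e k) (e′ (n ∸ k)))

  -- Mirror image of `⊗-suc`. Matching the two recursions gives commutativity without reversing the
  -- order of summation.
  ⊗-suc′ : ∀ f g n → (f ⊗ g) (suc n) ≡ g 0 * f (suc n) + (f ⊗ tail g) n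
  ⊗-suc′ f g zero    = lemma (f 0) (f 1) (g 0) (g 1)
    where
    lemma : ∀ a b c d → a * d + b * c ≡ c * b + a * d
    lemma = solveℤ
  ⊗-suc′ f g (suc n) = begin
    (f ⊗ g) (suc (suc n))                                             ≡⟨ ⊗-suc f g (suc n) ⟩
    a + (tail f ⊗ g) (suc n)                                          ≡⟨ cong (λ z → a + z) (⊗-suc′ (tail f) g n) ⟩
    a + (b + (tail f ⊗ tail g) n)                                     ≡⟨ lemma a b _ ⟩
    b + (a + (tail f ⊗ tail g) n)                                     ≡⟨ cong (λ z → b + z) (⊗-suc f (tail g) n) ⟨
    b + (f ⊗ tail g) (suc n)                                          ∎
    where
    open ≡-Reasoning
    a = f 0 * g (suc (suc n))
    b = g 0 * f (suc (suc n))
    lemma : ∀ a b c → a + (b + c) ≡ b + (a + c)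
    lemma = solveℤ

  ⊗-comm : ∀ f g → f ⊗ g ≗ g ⊗ f
  ⊗-comm f g zero    = ℤ.*-comm (f 0) (g 0)
  ⊗-comm f g (suc n) = trans (⊗-suc f g n)
    (trans (cong (λ z → f 0 * g (suc n) + z) (⊗-comm (tail f) g n)) (sym (⊗-suc′ g f n)))

  ⊗-distribʳ : ∀ h f g → (f ⊕ g) ⊗ h ≗ f ⊗ h ⊕ g ⊗ h
  ⊗-distribʳ h f g zero    = ℤ.*-distribʳ-+ (h 0) (f 0) (g 0)
  ⊗-distribʳ h f g (suc n) = begin
    ((f ⊕ g) ⊗ h) (suc n)                                     ≡⟨ ⊗-suc (f ⊕ g) h n ⟩
    (f 0 + g 0) * h (suc n) + (tail (f ⊕ g) ⊗ h) n            ≡⟨ cong (λ z → (f 0 + g 0) * h (suc n) + z) (⊗-distribʳ h (tail f) (tail g) n) ⟩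
    (f 0 + g 0) * h (suc n) + ((tail f ⊗ h) n + (tail g ⊗ h) n)
                                                              ≡⟨ lemma (f 0) (g 0) (h (suc n)) _ _ ⟩
    (f 0 * h (suc n) + (tail f ⊗ h) n) + (g 0 * h (suc n) + (tail g ⊗ h) n)
                                                              ≡⟨ cong₂ _+_ (⊗-suc f h n) (⊗-suc g h n) ⟨
    (f ⊗ h ⊕ g ⊗ h) (suc n)                                   ∎
    where
    open ≡-Reasoning
    lemma : ∀ a b c d e → (a + b) * c + (d + e) ≡ (a * c + d) + (b * c + e)
    lemma = solveℤ

  ·-⊗-assoc : ∀ c f g → (c · f) ⊗ g ≗ c · (f ⊗ g)
  ·-⊗-assoc c f g zero    = ℤ.*-assoc c (f 0) (g 0)
  ·-⊗-assoc c f g (suc n) = begin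
    ((c · f) ⊗ g) (suc n)                               ≡⟨ ⊗-suc (c · f) g n ⟩
    c * f 0 * g (suc n) + (c · tail f ⊗ g) n            ≡⟨ cong (λ z → c * f 0 * g (suc n) + z) (·-⊗-assoc c (tail f) g n) ⟩
    c * f 0 * g (suc n) + c * (tail f ⊗ g) n            ≡⟨ lemma c (f 0) (g (suc n)) _ ⟩
    c * (f 0 * g (suc n) + (tail f ⊗ g) n)              ≡⟨ cong (λ z → c * z) (⊗-suc f g n) ⟨
    c * (f ⊗ g) (suc n)                                 ∎
    where
    open ≡-Reasoning
    lemma : ∀ a b c d → a * b * c + a * d ≡ a * (b * c + d)
    lemma = solveℤ

  -- By `⊗-suc` the tail of f ⊗ g is f(0) · tail g ⊕ tail f ⊗ g, so induction on the coefficient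
  -- index, with f arbitrary, reduces the claim to `tail f`.
  ⊗-assoc : ∀ f g h → (f ⊗ g) ⊗ h ≗ f ⊗ (g ⊗ h)
  ⊗-assoc f g h zero    = ℤ.*-assoc (f 0) (g 0) (h 0)
  ⊗-assoc f g h (suc n) = begin
    ((f ⊗ g) ⊗ h) (suc n)
      ≡⟨ ⊗-suc (f ⊗ g) h n ⟩
    a * b * c + (tail (f ⊗ g) ⊗ h) n
      ≡⟨ cong (λ z → a * b * c + z) (⊗-cong {g = h} (⊗-suc f g) (λ _ → refl) n) ⟩
    a * b * c + ((a · tail g ⊕ tail f ⊗ g) ⊗ h) n
      ≡⟨ cong (λ z → a * b * c + z) (⊗-distribʳ h (a · tail g) (tail f ⊗ g) n) ⟩
    a * b * c + ((a · tail g ⊗ h) n + ((tail f ⊗ g) ⊗ h) n)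
      ≡⟨ cong₂ (λ y z → a * b * c + (y + z)) (·-⊗-assoc a (tail g) h n) (⊗-assoc (tail f) g h n) ⟩
    a * b * c + (a * (tail g ⊗ h) n + (tail f ⊗ (g ⊗ h)) n)
      ≡⟨ lemma a b c _ _ ⟩
    a * (b * c + (tail g ⊗ h) n) + (tail f ⊗ (g ⊗ h)) n
      ≡⟨ cong (λ z → a * z + (tail f ⊗ (g ⊗ h)) n) (⊗-suc g h n) ⟨
    a * (g ⊗ h) (suc n) + (tail f ⊗ (g ⊗ h)) n
      ≡⟨ ⊗-suc f (g ⊗ h) n ⟨
    (f ⊗ (g ⊗ h)) (suc n) ∎
    where
    open ≡-Reasoning
    a = f 0
    b = g 0
    c = h (suc n)
    lemma : ∀ a b c d e → a * b * c + (a * d + e) ≡ a * (b * c + d) + e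
    lemma = solveℤ

  zeroS-⊗ : ∀ f → zeroS ⊗ f ≗ zeroS
  zeroS-⊗ f zero    = refl
  zeroS-⊗ f (suc n) = trans (⊗-suc zeroS f n) (trans (ℤ.+-identityˡ _) (zeroS-⊗ f n))

  ⊗-identityˡ : ∀ f → oneS ⊗ f ≗ f
  ⊗-identityˡ f zero    = ℤ.*-identityˡ (f 0)
  ⊗-identityˡ f (suc n) = begin
    (oneS ⊗ f) (suc n)                    ≡⟨ ⊗-suc oneS f n ⟩
    1ℤ * f (suc n) + (zeroS ⊗ f) n        ≡⟨ cong₂ _+_ (ℤ.*-identityˡ (f (suc n))) (zeroS-⊗ f n) ⟩
    f (suc n) + 0ℤ                        ≡⟨ ℤ.+-identityʳ (f (suc n)) ⟩
    f (suc n)                             ∎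
    where open ≡-Reasoning

  seriesRing : CommutativeRing _ _
  seriesRing = record
    { Carrier = Series
    ; _≈_ = _≗_
    ; _+_ = _⊕_
    ; _*_ = _⊗_
    ; -_  = negS
    ; 0#  = zeroS
    ; 1#  = oneS
    ; isCommutativeRing = record
      { isRing = record
        { +-isAbelianGroup = record
          { isGroup = record
            { isMonoid = record
              { isSemigroup = record
                { isMagma = record
                  { isEquivalence = record
                    { refl  = λ _ → refl
                    ; sym   = λ e n → sym (e n)
                    ; trans = λ e e′ n → trans (e n) (e′ n)
                    }
                  ; ∙-cong = λ e e′ n → cong₂ _+_ (e n) (e′ n)
                  }
                ; assoc = λ f g h n → ℤ.+-assoc (f n) (g n) (h n)
                }
              ; identity = (λ f n → ℤ.+-identityˡ (f n)) , (λ f n → ℤ.+-identityʳ (f n))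
              }
            ; inverse = (λ f n → ℤ.+-inverseˡ (f n)) , (λ f n → ℤ.+-inverseʳ (f n))
            ; ⁻¹-cong = λ e n → cong -_ (e n)
            }
          ; comm = λ f g n → ℤ.+-comm (f n) (g n)
          }
        ; *-cong = ⊗-cong
        ; *-assoc = ⊗-assoc
        ; *-identity = ⊗-identityˡ , λ f n → trans (⊗-comm f oneS n) (⊗-identityˡ f n)
        ; distrib = (λ h f g n → trans (⊗-comm h (f ⊕ g) n)
                       (trans (⊗-distribʳ h f g n) (cong₂ _+_ (⊗-comm f h n) (⊗-comm g h n))))
                  , ⊗-distribʳ
        }
      ; *-comm = ⊗-comm
      }
    }

open SeriesRing

-- Integer coefficients for the ring solver

module IntegerCoefficients {c ℓ} (R : CommutativeRing c ℓ) where
  open CommutativeRing R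
  open Algebra.Properties.Ring ring using (-0#≈0#; -‿involutive; -‿distribˡ-*; -‿distribʳ-*; -‿+-comm)
  open Algebra.Properties.Semiring.Mult.TCOptimised semiring using (1+×; ×-homo-+; ×1-homo-*) renaming (_×_ to _×′_)
  open import Relation.Binary.Reasoning.Setoid setoid

  -- Taking the solver's coefficients from ℤ, where equality is decidable, lets it recognise
  -- cancellation in an arbitrary commutative ring.
  fromℤ : ℤ → Carrier
  fromℤ (+ n)    = n ×′ 1#
  fromℤ -[1+ n ] = - (suc n ×′ 1#)

  fromℤ-neg : ∀ i → fromℤ (ℤ.- i) ≈ - fromℤ i
  fromℤ-neg (+ zero)  = sym -0#≈0#
  fromℤ-neg (+ suc n) = refl
  fromℤ-neg -[1+ n ]  = sym (-‿involutive _)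

  fromℤ-⊖ : ∀ m n → fromℤ (m ℤ.⊖ n) ≈ m ×′ 1# - n ×′ 1#
  fromℤ-⊖ m       zero    = sym (trans (+-congˡ -0#≈0#) (+-identityʳ _))
  fromℤ-⊖ zero    (suc n) = sym (+-identityˡ _)
  fromℤ-⊖ (suc m) (suc n) = begin
    fromℤ (suc m ℤ.⊖ suc n)               ≡⟨ ≡.cong fromℤ (ℤ.[1+m]⊖[1+n]≡m⊖n m n) ⟩
    fromℤ (m ℤ.⊖ n)                       ≈⟨ fromℤ-⊖ m n ⟩
    x - y                                 ≈⟨ +-identityˡ _ ⟨
    0# + (x - y)                          ≈⟨ +-congʳ (-‿inverseʳ 1#) ⟨
    (1# - 1#) + (x - y)                   ≈⟨ +-assoc 1# (- 1#) _ ⟩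
    1# + (- 1# + (x - y))                 ≈⟨ +-congˡ (trans (sym (+-assoc _ _ _)) (trans (+-congʳ (+-comm _ _)) (+-assoc _ _ _))) ⟩
    1# + (x + (- 1# - y))                 ≈⟨ +-assoc _ _ _ ⟨
    (1# + x) + (- 1# - y)                 ≈⟨ +-cong (1+× m 1#) (trans (-‿cong (1+× n 1#)) (sym (-‿+-comm 1# y))) ⟨
    suc m ×′ 1# - suc n ×′ 1#             ∎
    where
    x = m ×′ 1#
    y = n ×′ 1#

  fromℤ-+ : ∀ i j → fromℤ (i ℤ.+ j) ≈ fromℤ i + fromℤ j
  fromℤ-+ (+ m)    (+ n)    = ×-homo-+ 1# m n
  fromℤ-+ (+ m)    -[1+ n ] = fromℤ-⊖ m (suc n)
  fromℤ-+ -[1+ m ] (+ n)    = trans (fromℤ-⊖ n (suc m)) (+-comm _ _)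
  fromℤ-+ -[1+ m ] -[1+ n ] = begin
    fromℤ (-[1+ m ] ℤ.+ -[1+ n ])                 ≡⟨ ≡.cong fromℤ (ℤ.neg-distrib-+ (+ suc m) (+ suc n)) ⟨
    fromℤ (ℤ.- (+ suc m ℤ.+ + suc n))             ≈⟨ fromℤ-neg (+ suc m ℤ.+ + suc n) ⟩
    - fromℤ (+ suc m ℤ.+ + suc n)                 ≈⟨ -‿cong (×-homo-+ 1# (suc m) (suc n)) ⟩
    - (suc m ×′ 1# + suc n ×′ 1#)                 ≈⟨ -‿+-comm _ _ ⟨
    - (suc m ×′ 1#) - suc n ×′ 1#                 ∎

  fromℤ-*⁺ : ∀ m j → fromℤ (+ m ℤ.* j) ≈ (m ×′ 1#) * fromℤ j
  fromℤ-*⁺ m (+ n)    = trans (reflexive (≡.cong fromℤ (≡.sym (ℤ.pos-* m n)))) (×1-homo-* m n)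
  fromℤ-*⁺ m -[1+ n ] = begin
    fromℤ (+ m ℤ.* -[1+ n ])            ≡⟨ ≡.cong fromℤ (ℤ.neg-distribʳ-* (+ m) (+ suc n)) ⟨
    fromℤ (ℤ.- (+ m ℤ.* + suc n))       ≈⟨ fromℤ-neg (+ m ℤ.* + suc n) ⟩
    - fromℤ (+ m ℤ.* + suc n)           ≈⟨ -‿cong (fromℤ-*⁺ m (+ suc n)) ⟩
    - ((m ×′ 1#) * (suc n ×′ 1#))       ≈⟨ -‿distribʳ-* _ _ ⟩
    (m ×′ 1#) * - (suc n ×′ 1#)         ∎

  fromℤ-* : ∀ i j → fromℤ (i ℤ.* j) ≈ fromℤ i * fromℤ j
  fromℤ-* (+ m)    j = fromℤ-*⁺ m j
  fromℤ-* -[1+ m ] j = begin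
    fromℤ (-[1+ m ] ℤ.* j)              ≡⟨ ≡.cong fromℤ (ℤ.neg-distribˡ-* (+ suc m) j) ⟨
    fromℤ (ℤ.- (+ suc m ℤ.* j))         ≈⟨ fromℤ-neg (+ suc m ℤ.* j) ⟩
    - fromℤ (+ suc m ℤ.* j)             ≈⟨ -‿cong (fromℤ-*⁺ (suc m) j) ⟩
    - ((suc m ×′ 1#) * fromℤ j)         ≈⟨ -‿distribˡ-* _ _ ⟩
    - (suc m ×′ 1#) * fromℤ j           ∎

  fromℤ-hom : CommutativeRing.rawRing ℤ.+-*-commutativeRing -Raw-AlmostCommutative⟶ fromCommutativeRing R
  fromℤ-hom = record
    { ⟦_⟧    = fromℤ
    ; +-homo = fromℤ-+
    ; *-homo = fromℤ-*
    ; -‿homo = fromℤ-neg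
    ; 0-homo = refl
    ; 1-homo = refl
    }

  open Algebra.Solver.Ring (CommutativeRing.rawRing ℤ.+-*-commutativeRing) (fromCommutativeRing R) fromℤ-hom
    (λ i j → map (λ i≡j → reflexive (≡.cong fromℤ i≡j)) (dec⇒maybe (i ℤ.≟ j))) public
    using (solve; _:=_; _:+_; _:*_; _:-_; :-_; con; Polynomial)

-- Arithmetic of indices and exponents

-- Case split used for all supports: either n is rewritten as m ∔ r, which removes truncated
-- subtraction, or n < m and the reciprocals involved are zero.
offset : ∀ m n → (∃ λ r → m ∔ r ≡ n) ⊎ n < m
offset m n with ℕ.≤-<-connex m n
... | inj₁ m≤n = inj₁ (n ∸ m , ℕ.m+[n∸m]≡n m≤n)
... | inj₂ n<m = inj₂ n<m

-- The binomial coefficient n(n-1)/2, without division.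
tri : ℕ → ℕ
tri zero    = 0
tri (suc n) = n ∔ tri n

tri-+ : ∀ m n → tri (m ∔ n) ≡ tri m ∔ tri n ∔ m ∙ n
tri-+ zero    n = ≡.sym (ℕ.+-identityʳ (tri n))
tri-+ (suc m) n = ≡.trans (≡.cong (m ∔ n ∔_) (tri-+ m n)) (lemma m n (tri m) (tri n))
  where
  lemma : ∀ m n a b → m ∔ n ∔ (a ∔ b ∔ m ∙ n) ≡ m ∔ a ∔ b ∔ (n ∔ m ∙ n)
  lemma = solveℕ

tri-double : ∀ n → tri n ∔ tri n ∔ n ≡ n ∙ n
tri-double zero    = ≡.refl
tri-double (suc n) = ≡.trans (lemma₁ n (tri n)) (≡.trans (≡.cong (λ z → suc (n ∔ n ∔ z)) (tri-double n)) (lemma₂ n))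
  where
  lemma₁ : ∀ n a → n ∔ a ∔ (n ∔ a) ∔ suc n ≡ suc (n ∔ n ∔ (a ∔ a ∔ n))
  lemma₁ = solveℕ
  lemma₂ : ∀ n → suc (n ∔ n ∔ n ∙ n) ≡ suc n ∙ suc n
  lemma₂ = solveℕ

-- The source of the four factors q^(l²) on the Borwein side; the nesting on the right is the one in
-- which `γ-triple` splits them off.
tri-triple : ∀ n → tri (n ∙ 3) ∔ n ≡ tri n ∔ (n ∙ n ∔ (n ∙ n ∔ (n ∙ n ∔ n ∙ n)))
tri-triple n = begin
  tri (n ∙ 3) ∔ n                                               ≡⟨ ≡.cong (λ z → tri z ∔ n) (lemma₀ n) ⟩
  tri (n ∔ n ∔ n) ∔ n                                           ≡⟨ ≡.cong (_∔ n) (tri-+ (n ∔ n) n) ⟩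
  tri (n ∔ n) ∔ tri n ∔ (n ∔ n) ∙ n ∔ n                         ≡⟨ ≡.cong (λ z → z ∔ tri n ∔ (n ∔ n) ∙ n ∔ n) (tri-+ n n) ⟩
  tri n ∔ tri n ∔ n ∙ n ∔ tri n ∔ (n ∔ n) ∙ n ∔ n               ≡⟨ lemma₁ n (tri n) ⟩
  tri n ∔ ((tri n ∔ tri n ∔ n) ∔ (n ∙ n ∔ (n ∙ n ∔ n ∙ n)))     ≡⟨ ≡.cong (λ z → tri n ∔ (z ∔ (n ∙ n ∔ (n ∙ n ∔ n ∙ n)))) (tri-double n) ⟩
  tri n ∔ (n ∙ n ∔ (n ∙ n ∔ (n ∙ n ∔ n ∙ n)))                   ∎
  where
  open ≡.≡-Reasoning
  lemma₀ : ∀ n → n ∙ 3 ≡ n ∔ n ∔ n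
  lemma₀ = solveℕ
  lemma₁ : ∀ n a → a ∔ a ∔ n ∙ n ∔ a ∔ (n ∔ n) ∙ n ∔ n ≡ a ∔ ((a ∔ a ∔ n) ∔ (n ∙ n ∔ (n ∙ n ∔ n ∙ n)))
  lemma₁ = solveℕ

-- An abstraction of ℤ[[q]] that hides coefficients and keeps powers of q atomic for the solver.
-- Inverting 1 - q^(n+1) suffices because every denominator is a finite product of such factors.
record QPowers {a ℓ} (R : CommutativeRing a ℓ) : Set (a ⊔ ℓ) where
  open CommutativeRing R
  field
    pw      : ℕ → Carrier
    pw-0    : pw 0 ≈ 1#
    pw-+    : ∀ m n → pw (m ∔ n) ≈ pw m * pw n
    inv     : ℕ → Carrier
    inv-law : ∀ n → (1# - pw (suc n)) * inv n ≈ 1#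

module QSeries {a ℓ} (R : CommutativeRing a ℓ) (Q : QPowers R) where

  open CommutativeRing R
  open QPowers Q
  open import Relation.Binary.Reasoning.Setoid setoid

  open IntegerCoefficients R

  𝟙 : ∀ {n} → Polynomial n
  𝟙 = con ℤ.1ℤ

  pw-≡ : ∀ {m n} → m ≡ n → pw m ≈ pw n
  pw-≡ e = reflexive (≡.cong pw e)

  0* : ∀ {x y} → x ≈ 0# → x * y ≈ 0#
  0* e = trans (*-congʳ e) (zeroˡ _)

  *0 : ∀ {x y} → y ≈ 0# → x * y ≈ 0#
  *0 e = trans (*-congˡ e) (zeroʳ _)

  -- Finite sums

  Σ≤ : ℕ → (ℕ → Carrier) → Carrier
  Σ≤ zero    f = f 0
  Σ≤ (suc n) f = Σ≤ n f + f (suc n)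

  Σ-cong≤ : ∀ n {f g} → (∀ k → k ≤ n → f k ≈ g k) → Σ≤ n f ≈ Σ≤ n g
  Σ-cong≤ zero    e = e 0 z≤n
  Σ-cong≤ (suc n) e = +-cong (Σ-cong≤ n λ k k≤n → e k (ℕ.m≤n⇒m≤1+n k≤n)) (e (suc n) ℕ.≤-refl)

  Σ-cong : ∀ n {f g} → (∀ k → f k ≈ g k) → Σ≤ n f ≈ Σ≤ n g
  Σ-cong n e = Σ-cong≤ n (λ k _ → e k)

  Σ-zero : ∀ n {f} → (∀ k → f k ≈ 0#) → Σ≤ n f ≈ 0#
  Σ-zero zero    e = e 0
  Σ-zero (suc n) e = trans (+-cong (Σ-zero n e) (e (suc n))) (+-identityˡ 0#)

  Σ-+ : ∀ n f g → Σ≤ n (λ k → f k + g k) ≈ Σ≤ n f + Σ≤ n g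
  Σ-+ zero    f g = refl
  Σ-+ (suc n) f g = trans (+-congʳ (Σ-+ n f g))
    (solve 4 (λ a b c d → (a :+ b) :+ (c :+ d) := (a :+ c) :+ (b :+ d)) refl _ _ _ _)

  Σ-*ˡ : ∀ n x f → Σ≤ n (λ k → x * f k) ≈ x * Σ≤ n f
  Σ-*ˡ zero    x f = refl
  Σ-*ˡ (suc n) x f = trans (+-congʳ (Σ-*ˡ n x f)) (sym (distribˡ x _ _))

  Σ-*ʳ : ∀ n x f → Σ≤ n (λ k → f k * x) ≈ Σ≤ n f * x
  Σ-*ʳ n x f = trans (Σ-cong n (λ k → *-comm (f k) x)) (trans (Σ-*ˡ n x f) (*-comm x _))

  Σ-*-Σ : ∀ m n f g → Σ≤ m f * Σ≤ n g ≈ Σ≤ m (λ i → Σ≤ n (λ j → f i * g j))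
  Σ-*-Σ m n f g = trans (sym (Σ-*ʳ m _ f)) (Σ-cong m (λ i → sym (Σ-*ˡ n (f i) g)))

  Σ-swap : ∀ m n (f : ℕ → ℕ → Carrier) → Σ≤ m (λ i → Σ≤ n (f i)) ≈ Σ≤ n (λ j → Σ≤ m (λ i → f i j))
  Σ-swap zero    n f = refl
  Σ-swap (suc m) n f = trans (+-congʳ (Σ-swap m n f)) (sym (Σ-+ n _ _))

  Σ-head : ∀ n f → Σ≤ (suc n) f ≈ f 0 + Σ≤ n (f ∘ suc)
  Σ-head zero    f = refl
  Σ-head (suc n) f = trans (+-congʳ (Σ-head n f)) (+-assoc _ _ _)

  Σ-only-0 : ∀ n f → (∀ k → f (suc k) ≈ 0#) → Σ≤ n f ≈ f 0
  Σ-only-0 zero    f e = refl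
  Σ-only-0 (suc n) f e = trans (+-cong (Σ-only-0 n f e) (e n)) (+-identityʳ (f 0))

  Σ-extend : ∀ k n f → (∀ i → n < i → f i ≈ 0#) → Σ≤ (k ∔ n) f ≈ Σ≤ n f
  Σ-extend zero    n f e = refl
  Σ-extend (suc k) n f e =
    trans (+-cong (Σ-extend k n f e) (e (suc (k ∔ n)) (s≤s (ℕ.m≤n+m n k)))) (+-identityʳ _)

  Σ-drop : ∀ k n f → (∀ i → i < k → f i ≈ 0#) → Σ≤ (k ∔ n) f ≈ Σ≤ n (λ i → f (k ∔ i))
  Σ-drop zero    n f e = refl
  Σ-drop (suc k) n f e = begin
    Σ≤ (suc (k ∔ n)) f           ≈⟨ Σ-head (k ∔ n) f ⟩
    f 0 + Σ≤ (k ∔ n) (f ∘ suc)   ≈⟨ +-cong (e 0 z<s) (Σ-drop k n (f ∘ suc) (λ i i<k → e (suc i) (s<s i<k))) ⟩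
    0# + Σ≤ n (λ i → f (suc k ∔ i)) ≈⟨ +-identityˡ _ ⟩
    Σ≤ n (λ i → f (suc k ∔ i))   ∎

  Σ-telescope : ∀ n u v (t t′ g : ℕ → Carrier) → g 0 ≈ 0# →
    (∀ m → u * t′ m - v * t m ≈ g (suc m) - g m) →
    u * Σ≤ n t′ - v * Σ≤ n t ≈ g (suc n)
  Σ-telescope zero    u v t t′ g g0 step = trans (step 0)
    (trans (+-congˡ (-‿cong g0)) (solve 1 (λ a → a :- con ℤ.0ℤ := a) refl _))
  Σ-telescope (suc n) u v t t′ g g0 step = begin
    u * (Σ≤ n t′ + t′ (suc n)) - v * (Σ≤ n t + t (suc n))
      ≈⟨ solve 6 (λ u v a b c d → u :* (a :+ b) :- v :* (c :+ d) := (u :* a :- v :* c) :+ (u :* b :- v :* d)) refl u v _ _ _ _ ⟩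
    (u * Σ≤ n t′ - v * Σ≤ n t) + (u * t′ (suc n) - v * t (suc n))
      ≈⟨ +-cong (Σ-telescope n u v t t′ g g0 step) (step (suc n)) ⟩
    g (suc n) + (g (suc (suc n)) - g (suc n))
      ≈⟨ solve 2 (λ a b → a :+ (b :- a) := b) refl _ _ ⟩
    g (suc (suc n)) ∎

  -- q-factorials and their reciprocals

  -- P n = (q;q)_n, I n = 1/(q;q)_n, and J a m = 1/(q;q)_(a-m), which is 0 for m > a.
  P : ℕ → Carrier
  P zero    = 1#
  P (suc n) = P n * (1# - pw (suc n))

  I : ℕ → Carrier
  I zero    = 1#
  I (suc n) = I n * inv n

  J : ℕ → ℕ → Carrier
  J a       zero    = I a
  J zero    (suc m) = 0#
  J (suc a) (suc m) = J a m

  P*I : ∀ n → P n * I n ≈ 1#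
  P*I zero    = *-identityˡ 1#
  P*I (suc n) = begin
    P n * (1# - pw (suc n)) * (I n * inv n)   ≈⟨ solve 4 (λ a b c d → a :* b :* (c :* d) := (a :* c) :* (b :* d)) refl _ _ _ _ ⟩
    (P n * I n) * ((1# - pw (suc n)) * inv n) ≈⟨ *-cong (P*I n) (inv-law n) ⟩
    1# * 1#                                   ≈⟨ *-identityˡ 1# ⟩
    1#                                        ∎

  I-suc : ∀ n → (1# - pw (suc n)) * I (suc n) ≈ I n
  I-suc n = begin
    (1# - pw (suc n)) * (I n * inv n)  ≈⟨ solve 3 (λ a b c → a :* (b :* c) := (a :* c) :* b) refl _ _ _ ⟩
    ((1# - pw (suc n)) * inv n) * I n  ≈⟨ *-congʳ (inv-law n) ⟩
    1# * I n                           ≈⟨ *-identityˡ _ ⟩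
    I n                                ∎

  J-+ : ∀ k a m → J (k ∔ a) (k ∔ m) ≡ J a m
  J-+ zero    a m = ≡.refl
  J-+ (suc k) a m = J-+ k a m

  J-offset : ∀ m r → J (m ∔ r) m ≡ I r
  J-offset zero    r = ≡.refl
  J-offset (suc m) r = J-offset m r

  J-< : ∀ {a m} → a < m → J a m ≡ 0#
  J-< {zero}  {suc m} _         = ≡.refl
  J-< {suc a} {suc m} (s<s a<m) = J-< a<m

  1-pw0 : 1# - pw 0 ≈ 0#
  1-pw0 = trans (+-congˡ (-‿cong pw-0)) (-‿inverseʳ 1#)

  -- For r = 0 the left side is out of range, hence zero, and the factor 1 - q^0 on the right
  -- agrees; so the boundary is no exception.
  J-suc : ∀ m r → J (m ∔ r) (suc m) ≈ (1# - pw r) * I r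
  J-suc zero    zero    = sym (0* 1-pw0)
  J-suc zero    (suc r) = sym (I-suc r)
  J-suc (suc m) r       = J-suc m r

  -- `J i k` removes the indices i < k and the hypothesis those above n, so shifting the summation
  -- variable by k leaves the range 0..n as it is.
  Σ-J : ∀ n k (f : ℕ → Carrier) → (∀ i → n < i → f i ≈ 0#) → Σ≤ n (λ i → J i k * f i) ≈ Σ≤ n (λ i → I i * f (k ∔ i))
  Σ-J n k f e = begin
    Σ≤ n (λ i → J i k * f i)                     ≈⟨ Σ-extend k n (λ i → J i k * f i) (λ i n<i → *0 (e i n<i)) ⟨
    Σ≤ (k ∔ n) (λ i → J i k * f i)               ≈⟨ Σ-drop k n (λ i → J i k * f i) (λ i i<k → 0* (reflexive (J-< i<k))) ⟩
    Σ≤ n (λ i → J (k ∔ i) k * f (k ∔ i))         ≈⟨ Σ-cong n (λ i → *-congʳ (reflexive (J-offset k i))) ⟩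
    Σ≤ n (λ i → I i * f (k ∔ i))                 ∎

  -- Three q-summations from one WZ certificate

  -- What the WZ step needs to know about the factor h: its values at three neighbouring points as
  -- multiples of a common k, which avoids division. Here η′ and ζ′ are q^(y-m) and q^(z-m), and 0
  -- stands for an infinite y or z. The first alternative covers points beyond the support of h.
  HasStep : ℕ → Carrier → Carrier → (ℕ → ℕ → Carrier) → Set (a ⊔ ℓ)
  HasStep c η ζ h = ∀ x m w → m ∔ w ≡ suc x →
    (h (suc x) m ≈ 0# × h x m ≈ 0# × h (suc x) (suc m) ≈ 0#) ⊎
    (∃₂ λ η′ ζ′ → ∃ λ k → η ≈ pw m * η′ × ζ ≈ pw m * ζ′
      × h (suc x) m ≈ (1# - pw w * pw m * pw m * pw c * η′ * ζ′) * k
      × h x m ≈ k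
      × h (suc x) (suc m) ≈ (1# - η′) * (1# - ζ′) * k)

  -- Three summations are needed, the cases (η, ζ) = (q^y, q^z), (q^y, 0) and (0, 0)
  -- of a q-Saalschütz sum whose factors depending on y and z are collected in h.
  module Saalschütz (c : ℕ) (η ζ : Carrier) (h : ℕ → ℕ → Carrier) (h-step : HasStep c η ζ h) where

    t : ℕ → ℕ → Carrier
    t x m = pw (m ∙ (m ∔ c)) * I m * I (m ∔ c) * J x m * h x m

    -- The WZ certificate: u x * t (suc x) m - v x * t x m is the difference of g x in m.
    g : ℕ → ℕ → Carrier
    g x m = - (pw (suc x ∸ m) * pw (m ∙ (m ∔ c)) * ((1# - pw m) * I m)
              * ((1# - pw (m ∔ c)) * I (m ∔ c)) * J (suc x) m * h (suc x) m)

    -- v x / u x is the ratio of the closed forms at suc x and x: 1/(q;q)_x and 1/(q;q)_(x+c)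
    -- contribute u, while (q;q)_(x+y+c) and (q;q)_(x+z+c) contribute v.
    u v : ℕ → Carrier
    u x = (1# - pw (suc x)) * (1# - pw (suc x ∔ c))
    v x = (1# - pw (suc x ∔ c) * η) * (1# - pw (suc x ∔ c) * ζ)

    all-zero : ∀ {u v} {t′ t g′ g : Carrier} → t′ ≈ 0# → t ≈ 0# → g′ ≈ 0# → g ≈ 0# → u * t′ - v * t ≈ g′ - g
    all-zero {u} {v} e₁ e₂ e₃ e₄ = trans (+-cong (*-congˡ e₁) (-‿cong (*-congˡ e₂)))
      (trans (solve 2 (λ u v → u :* con ℤ.0ℤ :- v :* con ℤ.0ℤ := con ℤ.0ℤ :- con ℤ.0ℤ) refl u v)
        (sym (+-cong e₃ (-‿cong e₄))))

    -0≈0 : ∀ {x} → x ≈ 0# → - x ≈ 0#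
    -0≈0 e = trans (-‿cong e) (solve 0 (:- con ℤ.0ℤ := con ℤ.0ℤ) refl)

    -- For w = 0, m is suc x and the truncated `x ∸ m` is not w - 1, but then 1 - q^w makes both
    -- sides vanish.
    pw-pred : ∀ m w x → m ∔ w ≡ suc x → pw 1 * pw (x ∸ m) * (1# - pw w) ≈ pw w * (1# - pw w)
    pw-pred m zero    x e = trans (*0 1-pw0) (sym (*0 1-pw0))
    pw-pred m (suc w) x e = *-congʳ (trans (sym (pw-+ 1 (x ∸ m))) (pw-≡ (≡.cong suc x∸m≡w)))
      where
      x∸m≡w : x ∸ m ≡ w
      x∸m≡w = ≡.trans (≡.cong (_∸ m) (≡.sym (ℕ.suc-injective (≡.trans (≡.sym (ℕ.+-suc m w)) e)))) (ℕ.m+n∸m≡n m w)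

    -- The WZ equation after its common factor is removed, with M = q^m, W = q^w, C = q^c and Y, Z
    -- for η′, ζ′: a polynomial identity in five independent variables.
    certificate-identity : ∀ M W C Y Z →
      (1# - M * W) * (1# - M * W * C) * (1# - W * M * M * C * Y * Z)
        - (1# - M * W * C * (M * Y)) * (1# - M * W * C * (M * Z)) * (1# - W)
      ≈ - (W * (1# - W) * (M * M * C) * ((1# - Y) * (1# - Z)))
        - - (W * (1# - M) * (1# - M * C) * (1# - W * M * M * C * Y * Z))
    certificate-identity = solve 5 (λ M W C Y Z →
      (𝟙 :- M :* W) :* (𝟙 :- M :* W :* C) :* (𝟙 :- W :* M :* M :* C :* Y :* Z)
        :- (𝟙 :- M :* W :* C :* (M :* Y)) :* (𝟙 :- M :* W :* C :* (M :* Z)) :* (𝟙 :- W)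
      := :- (W :* (𝟙 :- W) :* (M :* M :* C) :* ((𝟙 :- Y) :* (𝟙 :- Z)))
        :- :- (W :* (𝟙 :- M) :* (𝟙 :- M :* C) :* (𝟙 :- W :* M :* M :* C :* Y :* Z))) refl

    -- `J x m` is `J (suc x) (suc m)` by definition, so `J-suc` applies, even at m = suc x.
    J-pred : ∀ m w x → m ∔ w ≡ suc x → J x m ≈ (1# - pw w) * I w
    J-pred m w x e = trans (reflexive (≡.cong (λ z → J z (suc m)) (≡.sym e))) (J-suc m w)

    step : ∀ x m → u x * t (suc x) m - v x * t x m ≈ g x (suc m) - g x m
    step x m with offset m (suc x)
    ... | inj₂ x<m = all-zero (0* (*0 Jx′m)) (0* (*0 Jxm)) (-0≈0 (0* (*0 Jxm))) (-0≈0 (0* (*0 Jx′m)))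
      where
      Jx′m : J (suc x) m ≈ 0#
      Jx′m = reflexive (J-< x<m)
      Jxm : J x m ≈ 0#
      Jxm = reflexive (J-< (ℕ.<-trans (ℕ.n<1+n x) x<m))
    ... | inj₁ (w , e) with h-step x m w e
    ... | inj₁ (h₁ , h₂ , h₃) = all-zero (*0 h₁) (*0 h₂) (-0≈0 (*0 h₃)) (-0≈0 (*0 h₁))
    ... | inj₂ (η′ , ζ′ , k , η≈ , ζ≈ , h₁ , h₂ , h₃) = begin
      u x * t (suc x) m - v x * t x m
        ≈⟨ +-cong (*-cong u≈ t′≈) (-‿cong (*-cong v≈ t≈)) ⟩
      (1# - M * W) * (1# - M * W * C) * (X * i * i′ * j * (D * k))
        - (1# - M * W * C * (M * η′)) * (1# - M * W * C * (M * ζ′)) * (X * i * i′ * ((1# - W) * j) * k)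
        ≈⟨ solve 10 (λ a b c d X i i′ j k D → a :* (X :* i :* i′ :* j :* (D :* k)) :- b :* (X :* i :* i′ :* (c :* j) :* k)
             := (a :* D :- b :* c) :* (X :* i :* i′ :* j :* k)) refl _ _ _ 1# X i i′ j k D ⟩
      ((1# - M * W) * (1# - M * W * C) * D
        - (1# - M * W * C * (M * η′)) * (1# - M * W * C * (M * ζ′)) * (1# - W)) * (X * i * i′ * j * k)
        ≈⟨ *-congʳ (certificate-identity M W C η′ ζ′) ⟩
      (- (W * (1# - W) * (M * M * C) * ((1# - η′) * (1# - ζ′))) - - (W * (1# - M) * (1# - M * C) * D)) * (X * i * i′ * j * k)
        ≈⟨ solve 10 (λ a b c d X i i′ j k D → (:- (a :* b) :- :- (c :* D)) :* (X :* i :* i′ :* j :* k)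
             := :- (a :* X :* i :* i′ :* j :* (b :* k)) :- :- (c :* X :* i :* i′ :* j :* (D :* k))) refl _ _ _ 1# X i i′ j k D ⟩
      - (W * (1# - W) * (M * M * C) * X * i * i′ * j * ((1# - η′) * (1# - ζ′) * k))
        - - (W * (1# - M) * (1# - M * C) * X * i * i′ * j * (D * k))
        ≈⟨ +-cong (-‿cong g′≈) (-‿cong (-‿cong g≈)) ⟨
      g x (suc m) - g x m ∎
      where
      M = pw m
      W = pw w
      C = pw c
      X = pw (m ∙ (m ∔ c))
      i = I m
      i′ = I (m ∔ c)
      j = I w
      D = 1# - W * M * M * C * η′ * ζ′
      MW : pw (suc x) ≈ M * W
      MW = trans (pw-≡ (≡.sym e)) (pw-+ m w)
      MWC : pw (suc x ∔ c) ≈ M * W * C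
      MWC = trans (pw-+ (suc x) c) (*-congʳ MW)
      1- : ∀ {a b} → a ≈ b → 1# - a ≈ 1# - b
      1- e = +-congˡ (-‿cong e)
      u≈ : u x ≈ (1# - M * W) * (1# - M * W * C)
      u≈ = *-cong (1- MW) (1- MWC)
      v≈ : v x ≈ (1# - M * W * C * (M * η′)) * (1# - M * W * C * (M * ζ′))
      v≈ = *-cong (1- (*-cong MWC η≈)) (1- (*-cong MWC ζ≈))
      J′≈ : J (suc x) m ≈ j
      J′≈ = reflexive (≡.trans (≡.cong (λ z → J z m) (≡.sym e)) (J-offset m w))
      t′≈ : t (suc x) m ≈ X * i * i′ * j * (D * k)
      t′≈ = *-cong (*-congˡ J′≈) h₁
      t≈ : t x m ≈ X * i * i′ * ((1# - W) * j) * k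
      t≈ = *-cong (*-congˡ (J-pred m w x e)) h₂
      pw-square-suc : pw (suc m ∙ (suc m ∔ c)) ≈ X * (M * M * C) * pw 1
      pw-square-suc = begin
        pw (suc m ∙ (suc m ∔ c))              ≈⟨ pw-≡ (exponent m c) ⟩
        pw (m ∙ (m ∔ c) ∔ (m ∔ m ∔ c) ∔ 1)    ≈⟨ pw-+ (m ∙ (m ∔ c) ∔ (m ∔ m ∔ c)) 1 ⟩
        pw (m ∙ (m ∔ c) ∔ (m ∔ m ∔ c)) * pw 1 ≈⟨ *-congʳ (pw-+ _ (m ∔ m ∔ c)) ⟩
        X * pw (m ∔ m ∔ c) * pw 1             ≈⟨ *-congʳ (*-congˡ (trans (pw-+ (m ∔ m) c) (*-congʳ (pw-+ m m)))) ⟩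
        X * (M * M * C) * pw 1                ∎
        where
        exponent : ∀ m c → suc m ∙ (suc m ∔ c) ≡ m ∙ (m ∔ c) ∔ (m ∔ m ∔ c) ∔ 1
        exponent = solveℕ
      g′≈ : pw (x ∸ m) * pw (suc m ∙ (suc m ∔ c)) * ((1# - pw (suc m)) * I (suc m))
              * ((1# - pw (suc m ∔ c)) * I (suc m ∔ c)) * J x m * h (suc x) (suc m)
            ≈ W * (1# - W) * (M * M * C) * X * i * i′ * j * ((1# - η′) * (1# - ζ′) * k)
      g′≈ = begin
        pw (x ∸ m) * pw (suc m ∙ (suc m ∔ c)) * ((1# - pw (suc m)) * I (suc m))
              * ((1# - pw (suc m ∔ c)) * I (suc m ∔ c)) * J x m * h (suc x) (suc m)
          ≈⟨ *-cong (*-cong (*-cong (*-cong (*-congˡ pw-square-suc) (I-suc m)) (I-suc (m ∔ c))) (J-pred m w x e)) h₃ ⟩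
        pw (x ∸ m) * (X * (M * M * C) * pw 1) * i * i′ * ((1# - W) * j) * ((1# - η′) * (1# - ζ′) * k)
          ≈⟨ solve 9 (λ p X m q i i′ a j k → p :* (X :* m :* q) :* i :* i′ :* (a :* j) :* k
               := (q :* p :* a) :* (m :* X :* i :* i′ :* j :* k)) refl _ X _ _ i i′ _ j _ ⟩
        (pw 1 * pw (x ∸ m) * (1# - W)) * ((M * M * C) * X * i * i′ * j * ((1# - η′) * (1# - ζ′) * k))
          ≈⟨ *-congʳ (pw-pred m w x e) ⟩
        (W * (1# - W)) * ((M * M * C) * X * i * i′ * j * ((1# - η′) * (1# - ζ′) * k))
          ≈⟨ solve 7 (λ a X m i i′ j k → a :* (m :* X :* i :* i′ :* j :* k) := a :* m :* X :* i :* i′ :* j :* k) refl _ X _ i i′ j _ ⟩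
        W * (1# - W) * (M * M * C) * X * i * i′ * j * ((1# - η′) * (1# - ζ′) * k) ∎
      g≈ : pw (suc x ∸ m) * X * ((1# - M) * i) * ((1# - pw (m ∔ c)) * i′) * J (suc x) m * h (suc x) m
           ≈ W * (1# - M) * (1# - M * C) * X * i * i′ * j * (D * k)
      g≈ = begin
        pw (suc x ∸ m) * X * ((1# - M) * i) * ((1# - pw (m ∔ c)) * i′) * J (suc x) m * h (suc x) m
          ≈⟨ *-cong (*-cong (*-cong (*-congʳ (*-congʳ (pw-≡ w≡))) (*-congʳ (1- (pw-+ m c)))) J′≈) h₁ ⟩
        W * X * ((1# - M) * i) * ((1# - M * C) * i′) * j * (D * k)
          ≈⟨ solve 8 (λ W X a i b i′ j k → W :* X :* (a :* i) :* (b :* i′) :* j :* k := W :* a :* b :* X :* i :* i′ :* j :* k) refl W X _ i _ i′ j _ ⟩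
        W * (1# - M) * (1# - M * C) * X * i * i′ * j * (D * k) ∎
        where
        w≡ : suc x ∸ m ≡ w
        w≡ = ≡.trans (≡.cong (_∸ m) (≡.sym e)) (ℕ.m+n∸m≡n m w)

    recurrence : ∀ n x → x < n → Σ≤ n (t (suc x)) ≈ inv x * inv (x ∔ c) * v x * Σ≤ n (t x)
    recurrence n x x<n = begin
      S′                                              ≈⟨ trans (*-congʳ (*-identityˡ 1#)) (*-identityˡ S′) ⟨
      1# * 1# * S′                                    ≈⟨ *-congʳ (*-cong (inv-law x) (inv-law (x ∔ c))) ⟨
      (1# - pw (suc x)) * inv x * ((1# - pw (suc x ∔ c)) * inv (x ∔ c)) * S′
        ≈⟨ solve 5 (λ a b c d s → a :* b :* (c :* d) :* s := b :* d :* (a :* c :* s)) refl _ _ _ _ S′ ⟩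
      inv x * inv (x ∔ c) * (u x * S′)                ≈⟨ *-congˡ uS′≈vS ⟩
      inv x * inv (x ∔ c) * (v x * S)                 ≈⟨ *-assoc _ _ _ ⟨
      inv x * inv (x ∔ c) * v x * S                   ∎
      where
      S  = Σ≤ n (t x)
      S′ = Σ≤ n (t (suc x))
      g0 : g x 0 ≈ 0#
      g0 = -0≈0 (0* (0* (0* (*0 (0* 1-pw0)))))
      -- `J (suc x) (suc n)` reduces to `J x n`, which is zero because x < n.
      g-end : g x (suc n) ≈ 0#
      g-end = -0≈0 (0* (*0 (reflexive (J-< x<n))))
      uS′≈vS : u x * S′ ≈ v x * S
      uS′≈vS = begin
        u x * S′                          ≈⟨ solve 2 (λ a b → a := (a :- b) :+ b) refl _ (v x * S) ⟩
        (u x * S′ - v x * S) + v x * S    ≈⟨ +-congʳ (trans (Σ-telescope n (u x) (v x) (t x) (t (suc x)) (g x) g0 (step x)) g-end) ⟩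
        0# + v x * S                      ≈⟨ +-identityˡ _ ⟩
        v x * S                           ∎

    initial : ∀ n → Σ≤ n (t 0) ≈ I c * h 0 0
    initial n = begin
      Σ≤ n (t 0)                        ≈⟨ Σ-only-0 n (t 0) (λ k → 0* (zeroʳ _)) ⟩
      pw 0 * 1# * I c * 1# * h 0 0      ≈⟨ *-congʳ (*-congʳ (*-congʳ (*-congʳ pw-0))) ⟩
      1# * 1# * I c * 1# * h 0 0        ≈⟨ solve 2 (λ a b → 𝟙 :* 𝟙 :* a :* 𝟙 :* b := a :* b) refl _ _ ⟩
      I c * h 0 0                       ∎

  module _ (c : ℕ) where

    open Saalschütz c 0# 0# (λ _ _ → 1#)
      -- Zero, in the role of q^y with y infinite, is q^m times zero, so η′ = ζ′ = 0 at every m.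
      (λ x m w e → inj₂ (0# , 0# , 1# , sym (zeroʳ _) , sym (zeroʳ _)
        , solve 4 (λ w m c z → 𝟙 := (𝟙 :- w :* m :* m :* c :* con ℤ.0ℤ :* con ℤ.0ℤ) :* 𝟙) refl (pw w) (pw m) (pw c) 0#
        , refl
        , solve 0 (𝟙 := (𝟙 :- con ℤ.0ℤ) :* (𝟙 :- con ℤ.0ℤ) :* 𝟙) refl))

    -- After multiplication by (q;q)_x this counts partitions with parts at most x + c by their
    -- Durfee rectangle of m rows and m + c columns.
    durfee : ∀ n x → x ≤ n → Σ≤ n (λ m → pw (m ∙ (m ∔ c)) * I m * I (m ∔ c) * J x m) ≈ I x * I (x ∔ c)
    durfee n x x≤n = trans (Σ-cong n (λ m → sym (*-identityʳ _))) (sum x x≤n)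
      where
      sum : ∀ x → x ≤ n → Σ≤ n (t x) ≈ I x * I (x ∔ c)
      sum zero    _   = trans (initial n) (*-comm _ _)
      sum (suc x) x<n = begin
        Σ≤ n (t (suc x))                        ≈⟨ recurrence n x x<n ⟩
        inv x * inv (x ∔ c) * v x * Σ≤ n (t x)  ≈⟨ *-congˡ (sum x (ℕ.<⇒≤ x<n)) ⟩
        inv x * inv (x ∔ c) * v x * (I x * I (x ∔ c))
          ≈⟨ solve 5 (λ a b p i j → a :* b :* ((𝟙 :- p :* con ℤ.0ℤ) :* (𝟙 :- p :* con ℤ.0ℤ)) :* (i :* j)
               := (i :* a) :* (j :* b)) refl _ _ (pw (suc x ∔ c)) _ _ ⟩
        I (suc x) * I (suc x ∔ c)               ∎

  module _ (y c : ℕ) where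

    private
      h-step : HasStep c (pw y) 0# (λ _ m → J y m)
      h-step x m w e with offset m y
      ... | inj₂ y<m = inj₁ (reflexive (J-< y<m) , reflexive (J-< y<m) , reflexive (J-< (ℕ.<-trans y<m (ℕ.n<1+n m))))
      ... | inj₁ (r , ≡.refl) = inj₂ (pw r , 0# , I r , pw-+ m r , sym (zeroʳ _)
        , trans (reflexive (J-offset m r))
            (solve 5 (λ w m c p i → i := (𝟙 :- w :* m :* m :* c :* p :* con ℤ.0ℤ) :* i) refl (pw w) (pw m) (pw c) (pw r) _)
        , reflexive (J-offset m r)
        , trans (J-suc m r) (solve 2 (λ p i → (𝟙 :- p) :* i := (𝟙 :- p) :* (𝟙 :- con ℤ.0ℤ) :* i) refl _ _))

    open Saalschütz c (pw y) 0# (λ _ m → J y m) h-step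

    -- Multiplied by (q;q)_x (q;q)_(y+c), this is the q-Vandermonde sum of q^(m(m+c)) [x, m]
    -- [y+c, m+c], with value [x+y+c, y].
    vandermonde : ∀ n x → x ≤ n →
      Σ≤ n (λ m → pw (m ∙ (m ∔ c)) * I m * I (m ∔ c) * J x m * J y m)
        ≈ P (x ∔ y ∔ c) * (I x * I y * (I (x ∔ c) * I (y ∔ c)))
    vandermonde n zero    _   = begin
      Σ≤ n (t 0)                                            ≈⟨ initial n ⟩
      I c * I y                                             ≈⟨ *-identityˡ _ ⟨
      1# * (I c * I y)                                      ≈⟨ *-congʳ (P*I (y ∔ c)) ⟨
      P (y ∔ c) * I (y ∔ c) * (I c * I y)                   ≈⟨ solve 4 (λ p i a b → p :* i :* (a :* b) := p :* (𝟙 :* b :* (a :* i))) refl _ _ _ _ ⟩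
      P (y ∔ c) * (1# * I y * (I c * I (y ∔ c)))            ∎
    vandermonde n (suc x) x<n = begin
      Σ≤ n (t (suc x))                        ≈⟨ recurrence n x x<n ⟩
      inv x * inv (x ∔ c) * v x * Σ≤ n (t x)  ≈⟨ *-congˡ (vandermonde n x (ℕ.<⇒≤ x<n)) ⟩
      inv x * inv (x ∔ c) * v x * (P (x ∔ y ∔ c) * (I x * I y * (I (x ∔ c) * I (y ∔ c))))
        ≈⟨ solve 9 (λ a b q p r i j k l → a :* b :* ((𝟙 :- p :* q) :* (𝟙 :- p :* con ℤ.0ℤ)) :* (r :* (i :* j :* (k :* l)))
             := r :* (𝟙 :- p :* q) :* (i :* a :* j :* (k :* b :* l))) refl _ _ (pw y) (pw (suc x ∔ c)) _ _ _ _ _ ⟩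
      P (x ∔ y ∔ c) * (1# - pw (suc x ∔ c) * pw y) * (I (suc x) * I y * (I (suc x ∔ c) * I (y ∔ c)))
        ≈⟨ *-congʳ (*-congˡ (+-congˡ (-‿cong (trans (sym (pw-+ (suc x ∔ c) y)) (pw-≡ (exponent x y c)))))) ⟩
      P (suc x ∔ y ∔ c) * (I (suc x) * I y * (I (suc x ∔ c) * I (y ∔ c))) ∎
      where
      exponent : ∀ x y c → suc x ∔ c ∔ y ≡ suc x ∔ y ∔ c
      exponent = solveℕ

  module _ (y z c : ℕ) where

    private
      -- The numerator (q;q)_(x+y+z+c-m) is what balances the sum. It is the reason why h may depend
      -- on x in `HasStep`.
      h : ℕ → ℕ → Carrier
      h x m = P (x ∔ y ∔ z ∔ c ∸ m) * (J y m * J z m)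

      h-step : HasStep c (pw y) (pw z) h
      h-step x m w e with offset m y
      ... | inj₂ y<m = inj₁ (*0 (0* (reflexive (J-< y<m))) , *0 (0* (reflexive (J-< y<m)))
        , *0 (0* (reflexive (J-< (ℕ.<-trans y<m (ℕ.n<1+n m))))))
      ... | inj₁ (r , ≡.refl) with offset m z
      ... | inj₂ z<m = inj₁ (*0 (*0 (reflexive (J-< z<m))) , *0 (*0 (reflexive (J-< z<m)))
        , *0 (*0 (reflexive (J-< (ℕ.<-trans z<m (ℕ.n<1+n m))))))
      ... | inj₁ (s , ≡.refl) = inj₂ (pw r , pw s , P ε * (I r * I s) , pw-+ m r , pw-+ m s
        , (begin
            P (suc E ∸ m) * (J (m ∔ r) m * J (m ∔ s) m)
              ≈⟨ *-cong (reflexive (≡.cong P (ℕ.+-∸-assoc 1 m≤E))) Js ⟩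
            P ε * (1# - pw (suc ε)) * (I r * I s)
              ≈⟨ *-congʳ (*-congˡ (+-congˡ (-‿cong pw-suc-ε))) ⟩
            P ε * D * (I r * I s)
              ≈⟨ solve 3 (λ p d i → p :* d :* i := d :* (p :* i)) refl _ _ _ ⟩
            D * (P ε * (I r * I s)) ∎)
        , *-congˡ Js
        , trans (*-congˡ (*-cong (J-suc m r) (J-suc m s)))
            (solve 5 (λ p a i b j → p :* (a :* i :* (b :* j)) := a :* b :* (p :* (i :* j))) refl _ _ _ _ _))
        where
        E = x ∔ (m ∔ r) ∔ (m ∔ s) ∔ c
        ε = E ∸ m
        D = 1# - pw w * pw m * pw m * pw c * pw r * pw s
        Js = *-cong (reflexive (J-offset m r)) (reflexive (J-offset m s))
        E≡ : ∀ x m r s c → x ∔ (m ∔ r) ∔ (m ∔ s) ∔ c ≡ m ∔ (x ∔ r ∔ (m ∔ s) ∔ c)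
        E≡ = solveℕ
        m≤E : m ≤ E
        m≤E = ≡.subst (m ≤_) (≡.sym (E≡ x m r s c)) (ℕ.m≤m+n m _)
        sucE≡ : ∀ w m r s c → m ∔ w ∔ (m ∔ r) ∔ (m ∔ s) ∔ c ≡ m ∔ (w ∔ m ∔ m ∔ c ∔ r ∔ s)
        sucE≡ = solveℕ
        suc-ε : suc ε ≡ w ∔ m ∔ m ∔ c ∔ r ∔ s
        suc-ε = ≡.trans (≡.sym (ℕ.+-∸-assoc 1 m≤E))
          (≡.trans (≡.cong (_∸ m) (≡.trans (≡.cong (λ x → x ∔ (m ∔ r) ∔ (m ∔ s) ∔ c) (≡.sym e)) (sucE≡ w m r s c)))
            (ℕ.m+n∸m≡n m _))
        pw-suc-ε : pw (suc ε) ≈ pw w * pw m * pw m * pw c * pw r * pw s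
        pw-suc-ε = trans (pw-≡ suc-ε) (trans (pw-+ _ s) (*-congʳ (trans (pw-+ _ r) (*-congʳ
          (trans (pw-+ _ c) (*-congʳ (trans (pw-+ _ m) (*-congʳ (pw-+ w m)))))))))

    open Saalschütz c (pw y) (pw z) h h-step

    saalschütz : ∀ n x → x ≤ n →
      Σ≤ n (λ m → pw (m ∙ (m ∔ c)) * I m * I (m ∔ c) * J x m * (P (x ∔ y ∔ z ∔ c ∸ m) * (J y m * J z m)))
        ≈ P (x ∔ y ∔ c) * P (x ∔ z ∔ c) * P (y ∔ z ∔ c) * (I x * I y * I z * (I (x ∔ c) * I (y ∔ c) * I (z ∔ c)))
    saalschütz n zero    _   = begin
      Σ≤ n (t 0)                                            ≈⟨ initial n ⟩
      I c * (P (y ∔ z ∔ c) * (I y * I z))                   ≈⟨ solve 1 (λ a → a := 𝟙 :* 𝟙 :* a) refl _ ⟩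
      1# * 1# * (I c * (P (y ∔ z ∔ c) * (I y * I z)))       ≈⟨ *-congʳ (*-cong (P*I (y ∔ c)) (P*I (z ∔ c))) ⟨
      P (y ∔ c) * I (y ∔ c) * (P (z ∔ c) * I (z ∔ c)) * (I c * (P (y ∔ z ∔ c) * (I y * I z)))
        ≈⟨ solve 8 (λ p i q j c r y z → p :* i :* (q :* j) :* (c :* (r :* (y :* z)))
             := p :* q :* r :* (𝟙 :* y :* z :* (c :* i :* j))) refl _ _ _ _ _ _ _ _ ⟩
      P (y ∔ c) * P (z ∔ c) * P (y ∔ z ∔ c) * (1# * I y * I z * (I c * I (y ∔ c) * I (z ∔ c))) ∎
    saalschütz n (suc x) x<n = begin
      Σ≤ n (t (suc x))                        ≈⟨ recurrence n x x<n ⟩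
      inv x * inv (x ∔ c) * v x * Σ≤ n (t x)  ≈⟨ *-congˡ (saalschütz n x (ℕ.<⇒≤ x<n)) ⟩
      inv x * inv (x ∔ c) * v x
        * (P (x ∔ y ∔ c) * P (x ∔ z ∔ c) * P (y ∔ z ∔ c) * (I x * I y * I z * (I (x ∔ c) * I (y ∔ c) * I (z ∔ c))))
        ≈⟨ *-congʳ (*-congˡ (*-cong (1- y) (1- z))) ⟩
      inv x * inv (x ∔ c) * ((1# - pw (suc (x ∔ y ∔ c))) * (1# - pw (suc (x ∔ z ∔ c))))
        * (P (x ∔ y ∔ c) * P (x ∔ z ∔ c) * P (y ∔ z ∔ c) * (I x * I y * I z * (I (x ∔ c) * I (y ∔ c) * I (z ∔ c))))
        ≈⟨ solve 13 (λ a b d e p q r i y z j k l → a :* b :* (d :* e) :* (p :* q :* r :* (i :* y :* z :* (j :* k :* l)))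
             := p :* d :* (q :* e) :* r :* (i :* a :* y :* z :* (j :* b :* k :* l))) refl
             _ _ _ _ _ _ _ _ _ _ _ _ _ ⟩
      P (suc x ∔ y ∔ c) * P (suc x ∔ z ∔ c) * P (y ∔ z ∔ c) * (I (suc x) * I y * I z * (I (suc x ∔ c) * I (y ∔ c) * I (z ∔ c))) ∎
      where
      exponent : ∀ x y c → suc x ∔ c ∔ y ≡ suc x ∔ y ∔ c
      exponent = solveℕ
      1- : ∀ y → 1# - pw (suc x ∔ c) * pw y ≈ 1# - pw (suc (x ∔ y ∔ c))
      1- y = +-congˡ (-‿cong (trans (sym (pw-+ (suc x ∔ c) y)) (pw-≡ (exponent x y c))))

  -- Sums against the Bailey kernel

  -- The Bailey kernel 1/((q;q)_(n-l) (q;q)_(n+l)).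
  K : ℕ → ℕ → Carrier
  K n l = J n l * I (n ∔ l)

  K-< : ∀ {n l} → n < l → K n l ≈ 0#
  K-< n<l = 0* (reflexive (J-< n<l))

  K-+ : ∀ l x → K (l ∔ x) l ≈ I x * I (x ∔ (l ∔ l))
  K-+ l x = *-cong (reflexive (J-offset l x)) (reflexive (≡.cong I (index l x)))
    where
    index : ∀ l x → l ∔ x ∔ l ≡ x ∔ (l ∔ l)
    index = solveℕ

  -- Completing the square: r = l + m gives r² = l² + m(m+2l). The factor q^(l²) comes out, and the
  -- rest is a sum of the above type with c = 2l.
  Σ-K : ∀ n l (f : ℕ → Carrier) → (∀ r → n < r → f r ≈ 0#) →
    Σ≤ n (λ r → pw (r ∙ r) * f r * K r l)
      ≈ pw (l ∙ l) * Σ≤ n (λ m → pw (m ∙ (m ∔ (l ∔ l))) * I m * I (m ∔ (l ∔ l)) * f (l ∔ m))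
  Σ-K n l f f0 = begin
    Σ≤ n (λ r → pw (r ∙ r) * f r * (J r l * I (r ∔ l)))
      ≈⟨ Σ-cong n (λ r → solve 4 (λ p f j i → p :* f :* (j :* i) := j :* (p :* f :* i)) refl _ _ _ _) ⟩
    Σ≤ n (λ r → J r l * (pw (r ∙ r) * f r * I (r ∔ l)))
      ≈⟨ Σ-J n l _ (λ r n<r → 0* (*0 (f0 r n<r))) ⟩
    Σ≤ n (λ m → I m * (pw ((l ∔ m) ∙ (l ∔ m)) * f (l ∔ m) * I (l ∔ m ∔ l)))
      ≈⟨ Σ-cong n (λ m → trans
           (*-congˡ (*-cong (*-congʳ (trans (pw-≡ (square l m)) (pw-+ (l ∙ l) _))) (reflexive (≡.cong I (index l m)))))
           (solve 5 (λ a i p f j → i :* (a :* p :* f :* j) := a :* (p :* i :* j :* f)) refl _ _ _ _ _)) ⟩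
    Σ≤ n (λ m → pw (l ∙ l) * (pw (m ∙ (m ∔ (l ∔ l))) * I m * I (m ∔ (l ∔ l)) * f (l ∔ m)))
      ≈⟨ Σ-*ˡ n _ _ ⟩
    pw (l ∙ l) * Σ≤ n (λ m → pw (m ∙ (m ∔ (l ∔ l))) * I m * I (m ∔ (l ∔ l)) * f (l ∔ m)) ∎
    where
    index : ∀ l m → l ∔ m ∔ l ≡ m ∔ (l ∔ l)
    index = solveℕ
    square : ∀ l m → (l ∔ m) ∙ (l ∔ m) ≡ l ∙ l ∔ m ∙ (m ∔ (l ∔ l))
    square = solveℕ

  Σ-K-zero : ∀ n l (f : ℕ → Carrier) {x} → (∀ r → n < r → f r ≈ 0#) → (∀ m → f (l ∔ m) ≈ 0#) → x ≈ 0# →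
    Σ≤ n (λ r → pw (r ∙ r) * f r * K r l) ≈ pw (l ∙ l) * x
  Σ-K-zero n l f f0 fl x0 = trans (Σ-K n l f f0) (*-congˡ (trans (Σ-zero n (λ m → *0 (fl m))) (sym x0)))

  -- Bailey's lemma with both parameters infinite: `durfee` at x = N - l and c = 2l reproduces the
  -- kernel.
  bailey∞ : ∀ n N l → N ≤ n → Σ≤ n (λ r → pw (r ∙ r) * J N r * K r l) ≈ pw (l ∙ l) * K N l
  bailey∞ n N l N≤n with offset l N
  ... | inj₂ N<l = Σ-K-zero n l (J N) (λ r n<r → reflexive (J-< (ℕ.≤-<-trans N≤n n<r)))
        (λ m → reflexive (J-< (ℕ.<-≤-trans N<l (ℕ.m≤m+n l m)))) (K-< N<l)
  ... | inj₁ (x , ≡.refl) = begin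
    Σ≤ n (λ r → pw (r ∙ r) * J (l ∔ x) r * K r l)
      ≈⟨ Σ-K n l (J (l ∔ x)) (λ r n<r → reflexive (J-< (ℕ.≤-<-trans N≤n n<r))) ⟩
    pw (l ∙ l) * Σ≤ n (λ m → pw (m ∙ (m ∔ (l ∔ l))) * I m * I (m ∔ (l ∔ l)) * J (l ∔ x) (l ∔ m))
      ≈⟨ *-congˡ (Σ-cong n (λ m → *-congˡ (reflexive (J-+ l x m)))) ⟩
    pw (l ∙ l) * Σ≤ n (λ m → pw (m ∙ (m ∔ (l ∔ l))) * I m * I (m ∔ (l ∔ l)) * J x m)
      ≈⟨ *-congˡ (trans (durfee (l ∔ l) n x (ℕ.≤-trans (ℕ.m≤n+m x l) N≤n)) (sym (K-+ l x))) ⟩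
    pw (l ∙ l) * K (l ∔ x) l ∎

  -- `vandermonde` at x = A - l, y = B - l, c = 2l. It serves twice: with A = L - N₁ - N₂, B = N₂
  -- for the sum over N₃, and with A = L - 2l, B = L + 2l for the sum over N₁.
  bailey : ∀ n A B l → A ≤ n →
    Σ≤ n (λ r → pw (r ∙ r) * (J A r * J B r) * K r l) ≈ pw (l ∙ l) * (P (A ∔ B) * (K A l * K B l))
  bailey n A B l A≤n with offset l A | offset l B
  ... | inj₂ A<l | _ = Σ-K-zero n l _ (λ r n<r → 0* (reflexive (J-< (ℕ.≤-<-trans A≤n n<r))))
        (λ m → 0* (reflexive (J-< (ℕ.<-≤-trans A<l (ℕ.m≤m+n l m))))) (*0 (0* (K-< A<l)))
  ... | inj₁ _ | inj₂ B<l = Σ-K-zero n l _ (λ r n<r → 0* (reflexive (J-< (ℕ.≤-<-trans A≤n n<r))))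
        (λ m → *0 (reflexive (J-< (ℕ.<-≤-trans B<l (ℕ.m≤m+n l m))))) (*0 (*0 (K-< B<l)))
  ... | inj₁ (x , ≡.refl) | inj₁ (y , ≡.refl) = begin
    Σ≤ n (λ r → pw (r ∙ r) * (J (l ∔ x) r * J (l ∔ y) r) * K r l)
      ≈⟨ Σ-K n l _ (λ r n<r → 0* (reflexive (J-< (ℕ.≤-<-trans A≤n n<r)))) ⟩
    pw (l ∙ l) * Σ≤ n (λ m → pw (m ∙ (m ∔ (l ∔ l))) * I m * I (m ∔ (l ∔ l)) * (J (l ∔ x) (l ∔ m) * J (l ∔ y) (l ∔ m)))
      ≈⟨ *-congˡ (Σ-cong n (λ m → trans (*-congˡ (*-cong (reflexive (J-+ l x m)) (reflexive (J-+ l y m)))) (sym (*-assoc _ _ _)))) ⟩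
    pw (l ∙ l) * Σ≤ n (λ m → pw (m ∙ (m ∔ (l ∔ l))) * I m * I (m ∔ (l ∔ l)) * J x m * J y m)
      ≈⟨ *-congˡ (vandermonde y (l ∔ l) n x (ℕ.≤-trans (ℕ.m≤n+m x l) A≤n)) ⟩
    pw (l ∙ l) * (P (x ∔ y ∔ (l ∔ l)) * (I x * I y * (I (x ∔ (l ∔ l)) * I (y ∔ (l ∔ l)))))
      ≈⟨ *-congˡ (*-cong (reflexive (≡.cong P (index l x y)))
           (solve 4 (λ a b c d → a :* b :* (c :* d) := (a :* c) :* (b :* d)) refl _ _ _ _)) ⟩
    pw (l ∙ l) * (P (l ∔ x ∔ (l ∔ y)) * (I x * I (x ∔ (l ∔ l)) * (I y * I (y ∔ (l ∔ l)))))
      ≈⟨ *-congˡ (*-congˡ (*-cong (K-+ l x) (K-+ l y))) ⟨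
    pw (l ∙ l) * (P (l ∔ x ∔ (l ∔ y)) * (K (l ∔ x) l * K (l ∔ y) l)) ∎
    where
    index : ∀ l x y → x ∔ y ∔ (l ∔ l) ≡ l ∔ x ∔ (l ∔ y)
    index = solveℕ

  -- The q-Saalschütz counterpart of bailey, which turns the parameter l into 2l.
  bailey-double : ∀ n N D l → N ≤ n →
    Σ≤ n (λ r → pw (r ∙ r) * (P (N ∔ D ∔ D ∸ r) * J N r * (J D (r ∔ l) * J (D ∔ l) r)) * K r l)
      ≈ pw (l ∙ l) * (P (N ∔ D ∸ l) * P (N ∔ D ∔ l) * P (D ∔ D) * (I D * I D) * (K N l * K D (l ∔ l)))
  bailey-double n N D l N≤n with offset l N | offset (l ∔ l) D
  ... | inj₂ N<l | _ = Σ-K-zero n l _ (λ r n<r → 0* (*0 (reflexive (J-< (ℕ.≤-<-trans N≤n n<r)))))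
        (λ m → 0* (*0 (reflexive (J-< (ℕ.<-≤-trans N<l (ℕ.m≤m+n l m)))))) (*0 (0* (K-< N<l)))
  ... | inj₁ _ | inj₂ D<2l = Σ-K-zero n l _ (λ r n<r → 0* (*0 (reflexive (J-< (ℕ.≤-<-trans N≤n n<r)))))
        (λ m → *0 (0* (reflexive (J-< (ℕ.<-≤-trans D<2l (ℕ.+-monoˡ-≤ l (ℕ.m≤m+n l m))))))) (*0 (*0 (K-< D<2l)))
  ... | inj₁ (x , ≡.refl) | inj₁ (y , ≡.refl) = begin
    Σ≤ n (λ r → pw (r ∙ r) * (P (N ∔ D ∔ D ∸ r) * J N r * (J D (r ∔ l) * J (D ∔ l) r)) * K r l)
      ≈⟨ Σ-K n l _ (λ r n<r → 0* (*0 (reflexive (J-< (ℕ.≤-<-trans N≤n n<r))))) ⟩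
    pw (l ∙ l) * Σ≤ n (λ m → pw (m ∙ (m ∔ c)) * I m * I (m ∔ c)
        * (P (N ∔ D ∔ D ∸ (l ∔ m)) * J N (l ∔ m) * (J D (l ∔ m ∔ l) * J (D ∔ l) (l ∔ m))))
      ≈⟨ *-congˡ (Σ-cong n (λ m → trans
          (*-congˡ (*-cong (*-cong (reflexive (≡.cong P (P-index m))) (reflexive (J-+ l x m)))
                    (*-cong (reflexive (≡.trans (≡.cong (J D) (index l m)) (J-+ (l ∔ l) y m)))
                      (reflexive (≡.trans (≡.cong (λ d → J d (l ∔ m)) (ℕ.+-comm D l)) (J-+ l D m))))))
          (solve 7 (λ p i i′ q j y z → p :* i :* i′ :* (q :* j :* (y :* z)) := p :* i :* i′ :* j :* (q :* (y :* z))) refl _ _ _ _ _ _ _))) ⟩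
    pw (l ∙ l) * Σ≤ n (λ m → pw (m ∙ (m ∔ c)) * I m * I (m ∔ c) * J x m * (P (x ∔ y ∔ D ∔ c ∸ m) * (J y m * J D m)))
      -- Here x = N - l and y = D - 2l. With r = l + m the factor `J D (r ∔ l)` has become `J y m`,
      -- and `J (D ∔ l) r` has become `J D m`; thus D itself is the third Saalschütz parameter and
      -- 2l enters only through y and c.
      ≈⟨ *-congˡ (saalschütz y D c n x (ℕ.≤-trans (ℕ.m≤n+m x l) N≤n)) ⟩
    pw (l ∙ l) * (P (x ∔ y ∔ c) * P (x ∔ D ∔ c) * P (y ∔ D ∔ c) * (I x * I y * I D * (I (x ∔ c) * I (y ∔ c) * I (D ∔ c))))
      ≈⟨ *-congˡ (*-cong (*-cong (*-cong (reflexive (≡.cong P P₁)) (reflexive (≡.cong P (P₂ l x y)))) (reflexive (≡.cong P (P₃ l y))))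
                   (trans (*-congˡ (*-congʳ (*-congˡ (reflexive (≡.cong I (ℕ.+-comm y c))))))
                     (solve 5 (λ x y d x′ d′ → x :* y :* d :* (x′ :* d :* d′) := (d :* d) :* (x :* x′ :* (y :* d′))) refl _ _ _ _ _))) ⟩
    pw (l ∙ l) * (P (N ∔ D ∸ l) * P (N ∔ D ∔ l) * P (D ∔ D) * ((I D * I D) * (I x * I (x ∔ c) * (I y * I (D ∔ c)))))
      ≈⟨ *-congˡ (trans (sym (*-assoc _ _ _)) (*-congˡ (sym (*-cong (K-+ l x) (*-congʳ (reflexive (J-offset (l ∔ l) y))))))) ⟩
    pw (l ∙ l) * (P (N ∔ D ∸ l) * P (N ∔ D ∔ l) * P (D ∔ D) * (I D * I D) * (K N l * K D (l ∔ l))) ∎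
    where
    c = l ∔ l
    index : ∀ l m → l ∔ m ∔ l ≡ l ∔ l ∔ m
    index = solveℕ
    index₀ : ∀ l x y → l ∔ x ∔ (l ∔ l ∔ y) ∔ (l ∔ l ∔ y) ≡ l ∔ (x ∔ y ∔ (l ∔ l ∔ y) ∔ (l ∔ l))
    index₀ = solveℕ
    P-index : ∀ m → N ∔ D ∔ D ∸ (l ∔ m) ≡ x ∔ y ∔ D ∔ c ∸ m
    P-index m = ≡.trans (≡.cong (_∸ (l ∔ m)) (index₀ l x y)) (ℕ.[m+n]∸[m+o]≡n∸o l _ m)
    P₁ : x ∔ y ∔ c ≡ N ∔ D ∸ l
    P₁ = ≡.sym (≡.trans (≡.cong (_∸ l) (eq l x y)) (ℕ.m+n∸m≡n l _))
      where
      eq : ∀ l x y → l ∔ x ∔ (l ∔ l ∔ y) ≡ l ∔ (x ∔ y ∔ (l ∔ l))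
      eq = solveℕ
    P₂ : ∀ l x y → x ∔ (l ∔ l ∔ y) ∔ (l ∔ l) ≡ l ∔ x ∔ (l ∔ l ∔ y) ∔ l
    P₂ = solveℕ
    P₃ : ∀ l y → y ∔ (l ∔ l ∔ y) ∔ (l ∔ l) ≡ l ∔ l ∔ y ∔ (l ∔ l ∔ y)
    P₃ = solveℕ

  -- The sequence α and its orthogonality to K

  J-pw : ∀ n m → (pw m - pw n) * J n m ≈ pw m * J n (suc m)
  J-pw n m with offset m n
  ... | inj₂ n<m = trans (*0 (reflexive (J-< n<m))) (sym (*0 (reflexive (J-< (ℕ.<-trans n<m (ℕ.n<1+n m))))))
  ... | inj₁ (r , ≡.refl) = begin
    (pw m - pw (m ∔ r)) * J (m ∔ r) m      ≈⟨ *-cong (+-congˡ (-‿cong (pw-+ m r))) (reflexive (J-offset m r)) ⟩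
    (pw m - pw m * pw r) * I r             ≈⟨ solve 3 (λ m r i → (m :- m :* r) :* i := m :* ((𝟙 :- r) :* i)) refl _ _ _ ⟩
    pw m * ((1# - pw r) * I r)             ≈⟨ *-congˡ (J-suc m r) ⟨
    pw m * J (m ∔ r) (suc m)               ∎

  σ : ℕ → Carrier
  σ zero    = 1#
  σ (suc n) = - σ n

  -- The unit Bailey pair: 1 + q^l merges the terms at l and -l of the two-sided sequence (-1)^l
  -- q^(l(l-1)/2), so that index 0 is separate.
  α : ℕ → Carrier
  α zero    = 1#
  α (suc l) = σ (suc l) * pw (tri (suc l)) * (1# + pw (suc l))

  δ : ℕ → Carrier
  δ zero    = 1#
  δ (suc _) = 0#

  -- Partial sums have product form, and at r = suc n the factor `J (suc n) (suc r)` is zero; this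
  -- is what `α-unit` uses.
  α-telescope : ∀ n r →
    (1# - pw (suc n)) * Σ≤ r (λ l → α l * K (suc n) l)
      ≈ σ r * pw (tri (suc r)) * (J (suc n) (suc r) * I (suc n ∔ r))
  α-telescope n zero = begin
    (1# - pw (suc n)) * (1# * (I (suc n) * I (suc n ∔ 0)))
      ≈⟨ solve 3 (λ a b c → a :* (𝟙 :* (b :* c)) := a :* b :* c) refl _ _ _ ⟩
    (1# - pw (suc n)) * I (suc n) * I (suc n ∔ 0)
      ≈⟨ *-congʳ (I-suc n) ⟩
    I n * I (suc n ∔ 0)
      ≈⟨ trans (*-congʳ (trans (*-identityˡ _) pw-0)) (*-identityˡ _) ⟨
    1# * pw 0 * (I n * I (suc n ∔ 0)) ∎
  α-telescope n (suc r) = begin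
    (1# - pw N) * (Σ≤ r (λ l → α l * K N l) + α s * K N s)
      ≈⟨ distribˡ _ _ _ ⟩
    (1# - pw N) * Σ≤ r (λ l → α l * K N l) + (1# - pw N) * (α s * K N s)
      ≈⟨ +-congʳ (trans (α-telescope n r) (*-congˡ (*-congˡ I-step))) ⟩
    σ r * pw (tri s) * (J N s * ((1# - pw N * pw s) * I (N ∔ s))) + (1# - pw N) * (α s * K N s)
      -- The point is (1 - q^(N+s)) - (1 - q^N)(1 + q^s) = q^N - q^s.
      ≈⟨ solve 6 (λ a t n s j i →
           a :* t :* (j :* ((𝟙 :- n :* s) :* i)) :+ (𝟙 :- n) :* (:- a :* t :* (𝟙 :+ s) :* (j :* i))
             := :- a :* t :* (((s :- n) :* j) :* i)) refl (σ r) (pw (tri s)) (pw N) (pw s) (J N s) (I (N ∔ s)) ⟩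
    - σ r * pw (tri s) * ((pw s - pw N) * J N s * I (N ∔ s))
      ≈⟨ *-congˡ (*-congʳ J-step) ⟩
    - σ r * pw (tri s) * (pw s * J N (suc s) * I (N ∔ s))
      ≈⟨ solve 5 (λ a t s j i → :- a :* t :* (s :* j :* i) := :- a :* (s :* t) :* (j :* i)) refl _ _ _ _ _ ⟩
    - σ r * (pw s * pw (tri s)) * (J N (suc s) * I (N ∔ s))
      ≈⟨ *-congʳ (*-congˡ (pw-+ s (tri s))) ⟨
    - σ r * pw (tri (suc s)) * (J N (suc s) * I (N ∔ s)) ∎
    where
    N = suc n
    s = suc r
    I-step : I (N ∔ r) ≈ (1# - pw N * pw s) * I (N ∔ s)
    I-step = trans (sym (I-suc (N ∔ r))) (*-cong
      (+-congˡ (-‿cong (trans (pw-≡ (≡.sym (ℕ.+-suc N r))) (pw-+ N s)))) (reflexive (≡.cong I (≡.sym (ℕ.+-suc N r)))))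
    J-step : (pw s - pw N) * J N s ≈ pw s * J N (suc s)
    J-step = J-pw N s

  -- At N = 0 only l = 0 survives. For N > 0 the telescoped sum is divided by the invertible 1 -
  -- q^N.
  α-unit : ∀ n N → N ≤ n → Σ≤ n (λ l → α l * K N l) ≈ δ N
  α-unit n zero    _   = begin
    Σ≤ n (λ l → α l * K 0 l)   ≈⟨ Σ-only-0 n _ (λ l → *0 (zeroˡ _)) ⟩
    1# * (1# * 1#)             ≈⟨ trans (*-identityˡ _) (*-identityˡ _) ⟩
    1#                         ∎
  α-unit n (suc m) m<n = begin
    Σ≤ n (λ l → α l * K N l)               ≡⟨ ≡.cong (λ n → Σ≤ n (λ l → α l * K N l)) (ℕ.m∸n+n≡m m<n) ⟨
    Σ≤ (n ∸ N ∔ N) (λ l → α l * K N l)     ≈⟨ Σ-extend (n ∸ N) N _ (λ l N<l → *0 (K-< N<l)) ⟩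
    S                                      ≈⟨ *-identityˡ S ⟨
    1# * S                                 ≈⟨ *-congʳ (inv-law m) ⟨
    (1# - pw N) * inv m * S                ≈⟨ solve 3 (λ a b c → a :* b :* c := b :* (a :* c)) refl _ _ _ ⟩
    inv m * ((1# - pw N) * S)              ≈⟨ *0 (trans (α-telescope m N) (*0 (0* (reflexive (J-< (ℕ.n<1+n N)))))) ⟩
    0#                                     ∎
    where
    N = suc m
    S = Σ≤ N (λ l → α l * K N l)

  -- The four stages of the Bailey argument

  -- An exchange of finite sums. The kernel k is arbitrary because in the later stages it is K times
  -- further factors that depend on both r and l.
  bailey-transform : ∀ n (α F β G : ℕ → Carrier) (k : ℕ → ℕ → Carrier) →
    (∀ r → r ≤ n → Σ≤ n (λ l → α l * k r l) ≈ β r) →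
    (∀ l → Σ≤ n (λ r → F r * k r l) ≈ G l) →
    Σ≤ n (λ r → F r * β r) ≈ Σ≤ n (λ l → α l * G l)
  bailey-transform n α F β G k β≈ G≈ = begin
    Σ≤ n (λ r → F r * β r)                            ≈⟨ Σ-cong≤ n (λ r r≤n → *-congˡ (sym (β≈ r r≤n))) ⟩
    Σ≤ n (λ r → F r * Σ≤ n (λ l → α l * k r l))       ≈⟨ Σ-cong n (λ r → sym (Σ-*ˡ n _ _)) ⟩
    Σ≤ n (λ r → Σ≤ n (λ l → F r * (α l * k r l)))     ≈⟨ Σ-swap n n _ ⟩
    Σ≤ n (λ l → Σ≤ n (λ r → F r * (α l * k r l)))
      ≈⟨ Σ-cong n (λ l → trans (Σ-cong n (λ r → solve 3 (λ a b c → a :* (b :* c) := b :* (a :* c)) refl _ _ _)) (Σ-*ˡ n _ _)) ⟩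
    Σ≤ n (λ l → α l * Σ≤ n (λ r → F r * k r l))       ≈⟨ Σ-cong n (λ l → *-congˡ (G≈ l)) ⟩
    Σ≤ n (λ l → α l * G l)                            ∎

  α-first : ∀ n N → N ≤ n → Σ≤ n (λ l → α l * (pw (l ∙ l) * K N l)) ≈ I N
  α-first n N N≤n = begin
    Σ≤ n (λ l → α l * (pw (l ∙ l) * K N l))
      ≈⟨ bailey-transform n α (λ r → pw (r ∙ r) * J N r) δ _ K (α-unit n) (λ l → bailey∞ n N l N≤n) ⟨
    Σ≤ n (λ r → pw (r ∙ r) * J N r * δ r)
      ≈⟨ Σ-only-0 n _ (λ r → zeroʳ _) ⟩
    pw 0 * I N * 1#
      ≈⟨ trans (*-identityʳ _) (trans (*-congʳ pw-0) (*-identityˡ _)) ⟩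
    I N ∎

  -- The sum over N₃, for N = N₂ and D = L - N₁. The new kernel K(D-N,l) is written as
  -- `J D (N ∔ l) * J (D ∔ l) N`, which also makes sense for N > D and is the form that
  -- `bailey-double` sums.
  bailey-second : ∀ n D N l → D ≤ n →
    Σ≤ n (λ r → pw (r ∙ r) * (J D (N ∔ r) * J N r) * (pw (l ∙ l) * K r l))
      ≈ pw (l ∙ l) * (pw (l ∙ l) * (P D * (J D (N ∔ l) * J (D ∔ l) N) * K N l))
  bailey-second n D N l D≤n = begin
    Σ≤ n (λ r → pw (r ∙ r) * (J D (N ∔ r) * J N r) * (pw (l ∙ l) * K r l))
      ≈⟨ Σ-cong n (λ r → solve 3 (λ a b c → a :* (b :* c) := b :* (a :* c)) refl _ _ _) ⟩
    Σ≤ n (λ r → pw (l ∙ l) * (pw (r ∙ r) * (J D (N ∔ r) * J N r) * K r l))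
      ≈⟨ Σ-*ˡ n _ _ ⟩
    pw (l ∙ l) * Σ≤ n (λ r → pw (r ∙ r) * (J D (N ∔ r) * J N r) * K r l)
      ≈⟨ *-congˡ inner ⟩
    pw (l ∙ l) * (pw (l ∙ l) * (P D * (J D (N ∔ l) * J (D ∔ l) N) * K N l)) ∎
    where
    inner : Σ≤ n (λ r → pw (r ∙ r) * (J D (N ∔ r) * J N r) * K r l)
      ≈ pw (l ∙ l) * (P D * (J D (N ∔ l) * J (D ∔ l) N) * K N l)
    inner with offset N D
    ... | inj₂ D<N = trans (Σ-zero n (λ r → 0* (*0 (0* (D<N+ r))))) (sym (*0 (0* (*0 (0* (D<N+ l))))))
      where
      D<N+ : ∀ r → J D (N ∔ r) ≈ 0#
      D<N+ r = reflexive (J-< (ℕ.<-≤-trans D<N (ℕ.m≤m+n N r)))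
    ... | inj₁ (A , ≡.refl) = begin
      Σ≤ n (λ r → pw (r ∙ r) * (J (N ∔ A) (N ∔ r) * J N r) * K r l)
        ≈⟨ Σ-cong n (λ r → *-congʳ (*-congˡ (*-congʳ (reflexive (J-+ N A r))))) ⟩
      Σ≤ n (λ r → pw (r ∙ r) * (J A r * J N r) * K r l)
        ≈⟨ bailey n A N l (ℕ.≤-trans (ℕ.m≤n+m A N) D≤n) ⟩
      pw (l ∙ l) * (P (A ∔ N) * (J A l * I (A ∔ l) * K N l))
        ≈⟨ *-congˡ (trans (sym (*-assoc _ _ _)) (*-congʳ (*-cong (reflexive (≡.cong P (ℕ.+-comm A N)))
             (sym (*-cong (reflexive (J-+ N A l))
               (reflexive (≡.trans (≡.cong (λ d → J d N) (ℕ.+-assoc N A l)) (J-offset N (A ∔ l))))))))) ⟩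
      pw (l ∙ l) * (P (N ∔ A) * (J (N ∔ A) (N ∔ l) * J (N ∔ A ∔ l) N) * K N l) ∎

  -- The sum over N₂, for N = N₁. The prefactor (q;q)_D / (q;q)_(2D) and the (q;q)_D left by the sum
  -- over N₃ cancel the (q;q)_(2D) / (q;q)_D² from `bailey-double`.
  bailey-third : ∀ n N D l → N ≤ n →
    P D * I (D ∔ D) * Σ≤ n (λ r → pw (r ∙ r) * (P (N ∔ D ∔ D ∸ r) * J N r)
        * (pw (l ∙ l) * (pw (l ∙ l) * (P D * (J D (r ∔ l) * J (D ∔ l) r) * K r l))))
      ≈ pw (l ∙ l) * (pw (l ∙ l) * (pw (l ∙ l) * (P (N ∔ D ∸ l) * P (N ∔ D ∔ l) * (K N l * K D (l ∔ l)))))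
  bailey-third n N D l N≤n = begin
    P D * I (D ∔ D) * Σ≤ n (λ r → pw (r ∙ r) * (P (N ∔ D ∔ D ∸ r) * J N r)
        * (e * (e * (P D * (J D (r ∔ l) * J (D ∔ l) r) * K r l))))
      ≈⟨ *-congˡ (trans (Σ-cong n (λ r → solve 7 (λ r p j e d jj k → r :* (p :* j) :* (e :* (e :* (d :* jj :* k)))
           := (e :* e :* d) :* (r :* (p :* j :* jj) :* k)) refl _ _ _ e (P D) _ _)) (Σ-*ˡ n _ _)) ⟩
    P D * I (D ∔ D) * (e * e * P D * Σ≤ n (λ r → pw (r ∙ r) * (P (N ∔ D ∔ D ∸ r) * J N r * (J D (r ∔ l) * J (D ∔ l) r)) * K r l))
      ≈⟨ *-congˡ (*-congˡ (bailey-double n N D l N≤n)) ⟩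
    P D * I (D ∔ D) * (e * e * P D * (e * (P (N ∔ D ∸ l) * P (N ∔ D ∔ l) * P (D ∔ D) * (I D * I D) * (K N l * K D (l ∔ l)))))
      ≈⟨ solve 8 (λ p i e q r p₂ i₁ k → p :* i :* (e :* e :* p :* (e :* (q :* r :* p₂ :* (i₁ :* i₁) :* k)))
           := (p :* i₁) :* (p :* i₁) :* (p₂ :* i) :* (e :* (e :* (e :* (q :* r :* k))))) refl (P D) (I (D ∔ D)) e _ _ (P (D ∔ D)) (I D) _ ⟩
    P D * I D * (P D * I D) * (P (D ∔ D) * I (D ∔ D)) * (e * (e * (e * (P (N ∔ D ∸ l) * P (N ∔ D ∔ l) * (K N l * K D (l ∔ l))))))
      ≈⟨ *-congʳ (*-cong (*-cong (P*I D) (P*I D)) (P*I (D ∔ D))) ⟩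
    1# * 1# * 1# * (e * (e * (e * (P (N ∔ D ∸ l) * P (N ∔ D ∔ l) * (K N l * K D (l ∔ l))))))
      ≈⟨ solve 1 (λ x → 𝟙 :* 𝟙 :* 𝟙 :* x := x) refl _ ⟩
    e * (e * (e * (P (N ∔ D ∸ l) * P (N ∔ D ∔ l) * (K N l * K D (l ∔ l))))) ∎
    where
    e = pw (l ∙ l)

  -- Both sides encode 1/(q;q)_(L-m-c). This moves the index N₁ from the first argument of `J`,
  -- where it cannot be summed, to the second.
  J-∸ : ∀ L m c → m ≤ L → c ≤ L → J (L ∸ m) c ≡ J (L ∸ c) m
  J-∸ L m c m≤L c≤L with offset (m ∔ c) L
  ... | inj₂ L<m+c = ≡.trans (J-< (<-∸ m≤L L<m+c))
          (≡.sym (J-< (<-∸ c≤L (≡.subst (L <_) (ℕ.+-comm m c) L<m+c))))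
    where
    <-∸ : ∀ {a b} → a ≤ L → L < a ∔ b → L ∸ a < b
    <-∸ {a} {b} a≤L L<a+b = ℕ.+-cancelˡ-< a _ _ (≡.subst (_< a ∔ b) (≡.sym (ℕ.m+[n∸m]≡n a≤L)) L<a+b)
  ... | inj₁ (r , ≡.refl) = ≡.trans (≡.trans (≡.cong (λ d → J d c) L∸m) (J-offset c r))
          (≡.sym (≡.trans (≡.cong (λ d → J d m) L∸c) (J-offset m r)))
    where
    L∸m : m ∔ c ∔ r ∸ m ≡ c ∔ r
    L∸m = ≡.trans (≡.cong (_∸ m) (ℕ.+-assoc m c r)) (ℕ.m+n∸m≡n m (c ∔ r))
    L∸c : m ∔ c ∔ r ∸ c ≡ m ∔ r
    L∸c = ≡.trans (≡.cong (_∸ c) (eq m c r)) (ℕ.m+n∸m≡n c (m ∔ r))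
      where
      eq : ∀ m c r → m ∔ c ∔ r ≡ c ∔ (m ∔ r)
      eq = solveℕ

  -- The sum over N₁. As K(L-N,2l) is 1/((q;q)_(L-2l-N) (q;q)_(L+2l-N)), `bailey` gives K(L-2l,l)
  -- K(L+2l,l). Its outer factors form K(L,3l), and the inner ones cancel (q;q)_(L-l) (q;q)_(L+l).
  bailey-fourth : ∀ L l →
    Σ≤ L (λ N → pw (N ∙ N) * (P (L ∸ l) * P (L ∔ l) * (K N l * K (L ∸ N) (l ∔ l))))
      ≈ pw (l ∙ l) * (P (L ∔ L) * K L (l ∔ l ∔ l))
  bailey-fourth L l with offset (l ∔ l) L
  ... | inj₂ L<2l = trans (Σ-zero L (λ N → *0 (*0 (*0 (K-< (ℕ.≤-<-trans (ℕ.m∸n≤m L N) L<2l))))))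
                          (sym (*0 (*0 (K-< (ℕ.<-≤-trans L<2l (ℕ.m≤m+n (l ∔ l) l))))))
  ... | inj₁ (A , ≡.refl) = begin
    Σ≤ L (λ N → pw (N ∙ N) * (P (L ∸ l) * P (L ∔ l) * (K N l * K (L ∸ N) (l ∔ l))))
      ≈⟨ Σ-cong≤ L (λ N N≤L → trans (*-congˡ (*-congˡ (*-congˡ (K-∸ N N≤L))))
           (solve 4 (λ a b c d → a :* (b :* (c :* d)) := b :* (a :* d :* c)) refl _ _ _ _)) ⟩
    Σ≤ L (λ N → P (L ∸ l) * P (L ∔ l) * (pw (N ∙ N) * (J A N * J (L ∔ (l ∔ l)) N) * K N l))
      ≈⟨ Σ-*ˡ L _ _ ⟩
    P (L ∸ l) * P (L ∔ l) * Σ≤ L (λ N → pw (N ∙ N) * (J A N * J (L ∔ (l ∔ l)) N) * K N l)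
      ≈⟨ *-congˡ (bailey L A (L ∔ (l ∔ l)) l (ℕ.m≤n+m A (l ∔ l))) ⟩
    P (L ∸ l) * P (L ∔ l) * (pw (l ∙ l) * (P (A ∔ (L ∔ (l ∔ l))) * (K A l * K (L ∔ (l ∔ l)) l)))
      ≈⟨ *-congˡ (*-congˡ (*-cong (reflexive (≡.cong P (total l A))) (*-cong KA KL))) ⟩
    P (L ∸ l) * P (L ∔ l) * (pw (l ∙ l) * (P (L ∔ L) * (J L (l ∔ l ∔ l) * I (L ∸ l) * (I (L ∔ l) * I (L ∔ (l ∔ l ∔ l))))))
      ≈⟨ solve 8 (λ p q e r j i k h → p :* q :* (e :* (r :* (j :* i :* (k :* h)))) := (p :* i) :* (q :* k) :* (e :* (r :* (j :* h)))) refl _ _ _ _ _ _ _ _ ⟩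
    P (L ∸ l) * I (L ∸ l) * (P (L ∔ l) * I (L ∔ l)) * (pw (l ∙ l) * (P (L ∔ L) * K L (l ∔ l ∔ l)))
      ≈⟨ *-congʳ (*-cong (P*I (L ∸ l)) (P*I (L ∔ l))) ⟩
    1# * 1# * (pw (l ∙ l) * (P (L ∔ L) * K L (l ∔ l ∔ l)))
      ≈⟨ solve 1 (λ x → 𝟙 :* 𝟙 :* x := x) refl _ ⟩
    pw (l ∙ l) * (P (L ∔ L) * K L (l ∔ l ∔ l)) ∎
    where
    total : ∀ l A → A ∔ (l ∔ l ∔ A ∔ (l ∔ l)) ≡ l ∔ l ∔ A ∔ (l ∔ l ∔ A)
    total = solveℕ
    K-∸ : ∀ N → N ≤ L → K (L ∸ N) (l ∔ l) ≈ J A N * J (L ∔ (l ∔ l)) N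
    K-∸ N N≤L = *-cong
      (reflexive (≡.trans (J-∸ L N (l ∔ l) N≤L (ℕ.m≤m+n (l ∔ l) A)) (≡.cong (λ d → J d N) (ℕ.m+n∸m≡n (l ∔ l) A))))
      (reflexive (≡.sym (≡.trans (≡.cong (λ d → J d N) eq) (J-offset N (L ∸ N ∔ (l ∔ l))))))
      where
      eq : L ∔ (l ∔ l) ≡ N ∔ (L ∸ N ∔ (l ∔ l))
      eq = ≡.trans (≡.cong (_∔ (l ∔ l)) (≡.sym (ℕ.m+[n∸m]≡n N≤L))) (ℕ.+-assoc N (L ∸ N) (l ∔ l))
    KA : K A l ≈ J L (l ∔ l ∔ l) * I (L ∸ l)
    KA = *-cong (reflexive (≡.sym (J-+ (l ∔ l) A l)))
                (reflexive (≡.cong I (≡.sym (≡.trans (≡.cong (_∸ l) (eq l A)) (ℕ.m+n∸m≡n l (A ∔ l))))))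
      where
      eq : ∀ l A → l ∔ l ∔ A ≡ l ∔ (A ∔ l)
      eq = solveℕ
    KL : K (L ∔ (l ∔ l)) l ≈ I (L ∔ l) * I (L ∔ (l ∔ l ∔ l))
    KL = *-cong (reflexive (≡.trans (≡.cong (λ d → J d l) (eq L l)) (J-offset l (L ∔ l))))
                (reflexive (≡.cong I (ℕ.+-assoc L (l ∔ l) l)))
      where
      eq : ∀ L l → L ∔ (l ∔ l) ≡ l ∔ (L ∔ l)
      eq = solveℕ

  -- The multisum

  triple : ∀ m n (X : ℕ → ℕ → ℕ → Carrier) →
    Σ≤ m (λ i → Σ≤ n (λ j → Σ≤ n (λ k → X i j k))) ≈ Σ≤ n (λ k → Σ≤ n (λ j → Σ≤ m (λ i → X i j k)))
  triple m n X = trans (Σ-cong m (λ i → Σ-swap n n (X i)))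
    (trans (Σ-swap m n _) (Σ-cong n (λ k → Σ-swap m n (λ i j → X i j k))))

  -- The summand in the variables N₁, N₂, N₃, without the reciprocals of (q;q)_(nᵢ); its last factor
  -- replaces the range condition N₁+N₂+N₃ ≤ L.
  Θ : ℕ → ℕ → ℕ → ℕ → Carrier
  Θ L N₁ N₂ N₃ = pw (N₁ ∙ N₁ ∔ N₂ ∙ N₂ ∔ N₃ ∙ N₃) * P (L ∸ N₁) * P (L ∔ L ∸ N₁ ∸ N₂)
    * I (L ∸ N₁ ∔ (L ∸ N₁)) * J L (N₁ ∔ N₂ ∔ N₃)

  Θ-outside : ∀ L n₁ n₂ n₃ → L < n₁ ∔ n₂ ∔ n₃ ∔ (n₂ ∔ n₃) ∔ n₃ →
    I n₁ * (I n₂ * (I n₃ * Θ L (n₁ ∔ n₂ ∔ n₃) (n₂ ∔ n₃) n₃)) ≈ 0#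
  Θ-outside L n₁ n₂ n₃ L<N = *0 (*0 (*0 (*0 (reflexive (J-< L<N)))))

  -- P′ and I′ are placeholders for `qfac` and `qfacInv`, which live in the concrete ring only.
  Θ-inside : ∀ (P′ I′ : ℕ → Carrier) → (∀ n → P′ n ≈ P n) → (∀ n → I′ n ≈ I n) → ∀ L n₁ n₂ n₃ →
    let N₁ = n₁ ∔ n₂ ∔ n₃
        N₂ = n₂ ∔ n₃
    in N₁ ∔ N₂ ∔ n₃ ≤ L →
    pw (N₁ ∙ N₁ ∔ N₂ ∙ N₂ ∔ n₃ ∙ n₃) * P′ (L ∸ N₁) * P′ (2 ∙ L ∸ N₁ ∸ N₂)
      * I′ (2 ∙ L ∸ 2 ∙ N₁) * I′ (L ∸ N₁ ∸ N₂ ∸ n₃) * I′ n₁ * I′ n₂ * I′ n₃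
    ≈ I n₁ * (I n₂ * (I n₃ * Θ L N₁ N₂ n₃))
  Θ-inside P′ I′ P′≈ I′≈ L n₁ n₂ n₃ N≤L = begin
    e * P′ (L ∸ N₁) * P′ (2 ∙ L ∸ N₁ ∸ N₂) * I′ (2 ∙ L ∸ 2 ∙ N₁) * I′ (L ∸ N₁ ∸ N₂ ∸ n₃) * I′ n₁ * I′ n₂ * I′ n₃
      ≈⟨ *-cong (*-cong (*-cong (*-cong (*-cong (*-cong
           (*-congˡ (P′≈ _))
           (trans (P′≈ _) (reflexive (≡.cong (λ m → P (m ∸ N₁ ∸ N₂)) (2∙ L)))))
           (trans (I′≈ _) (reflexive (≡.cong I (≡.trans (≡.sym (ℕ.*-distribˡ-∸ 2 L N₁)) (2∙ (L ∸ N₁)))))))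
           (trans (I′≈ _) (reflexive J≡)))
           (I′≈ n₁)) (I′≈ n₂)) (I′≈ n₃) ⟩
    Θ L N₁ N₂ n₃ * I n₁ * I n₂ * I n₃
      ≈⟨ solve 4 (λ t a b c → t :* a :* b :* c := a :* (b :* (c :* t))) refl _ _ _ _ ⟩
    I n₁ * (I n₂ * (I n₃ * Θ L N₁ N₂ n₃)) ∎
    where
    N₁ = n₁ ∔ n₂ ∔ n₃
    N₂ = n₂ ∔ n₃
    e  = pw (N₁ ∙ N₁ ∔ N₂ ∙ N₂ ∔ n₃ ∙ n₃)
    2∙ : ∀ m → 2 ∙ m ≡ m ∔ m
    2∙ m = ≡.cong (m ∔_) (ℕ.+-identityʳ m)
    J≡ : I (L ∸ N₁ ∸ N₂ ∸ n₃) ≡ J L (N₁ ∔ N₂ ∔ n₃)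
    J≡ = ≡.trans (≡.cong I (≡.trans (≡.cong (_∸ n₃) (ℕ.∸-+-assoc L N₁ N₂)) (ℕ.∸-+-assoc L (N₁ ∔ N₂) n₃)))
      (≡.sym (≡.trans (≡.cong (λ m → J m (N₁ ∔ N₂ ∔ n₃)) (≡.sym (ℕ.m+[n∸m]≡n N≤L))) (J-offset (N₁ ∔ N₂ ∔ n₃) _)))

  -- The substitution N₂ = N₃ + n₂, N₁ = N₂ + n₁, one variable at a time by `Σ-J`; 1/(q;q)_(n₁)
  -- becomes `J N₁ N₂`. The sum over n₁ is first made innermost because N₁ depends on n₂ and n₃.
  Σ-partial-sums : ∀ L →
    Σ≤ L (λ n₁ → Σ≤ L λ n₂ → Σ≤ L λ n₃ → I n₁ * (I n₂ * (I n₃ * Θ L (n₁ ∔ n₂ ∔ n₃) (n₂ ∔ n₃) n₃)))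
      ≈ Σ≤ L (λ N₁ → Σ≤ L λ N₂ → Σ≤ L λ N₃ → J N₂ N₃ * (J N₁ N₂ * (I N₃ * Θ L N₁ N₂ N₃)))
  Σ-partial-sums L = begin
    Σ≤ L (λ n₁ → Σ≤ L λ n₂ → Σ≤ L λ n₃ → I n₁ * (I n₂ * (I n₃ * Θ L (n₁ ∔ n₂ ∔ n₃) (n₂ ∔ n₃) n₃)))
      ≈⟨ triple L L _ ⟩
    Σ≤ L (λ n₃ → Σ≤ L λ n₂ → Σ≤ L λ n₁ → I n₁ * (I n₂ * (I n₃ * Θ L (n₁ ∔ n₂ ∔ n₃) (n₂ ∔ n₃) n₃)))
      ≈⟨ Σ-cong L (λ n₃ → Σ-cong L (λ n₂ → sum-n₁ n₂ n₃)) ⟩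
    Σ≤ L (λ n₃ → Σ≤ L λ n₂ → I n₂ * g n₃ (n₃ ∔ n₂))
      ≈⟨ Σ-cong L (λ n₃ → Σ-J L n₃ (g n₃) (λ N₂ L<N₂ → Σ-zero L (λ N₁ → *0 (*0 (*0 (reflexive (J-<
           (ℕ.<-≤-trans L<N₂ (ℕ.≤-trans (ℕ.m≤n+m N₂ N₁) (ℕ.m≤m+n (N₁ ∔ N₂) n₃)))))))))) ⟨
    Σ≤ L (λ N₃ → Σ≤ L λ N₂ → J N₂ N₃ * g N₃ N₂)
      ≈⟨ Σ-cong L (λ N₃ → Σ-cong L (λ N₂ → Σ-*ˡ L _ _)) ⟨
    Σ≤ L (λ N₃ → Σ≤ L λ N₂ → Σ≤ L λ N₁ → J N₂ N₃ * (J N₁ N₂ * (I N₃ * Θ L N₁ N₂ N₃)))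
      ≈⟨ triple L L _ ⟨
    Σ≤ L (λ N₁ → Σ≤ L λ N₂ → Σ≤ L λ N₃ → J N₂ N₃ * (J N₁ N₂ * (I N₃ * Θ L N₁ N₂ N₃))) ∎
    where
    g : ℕ → ℕ → Carrier
    g N₃ N₂ = Σ≤ L λ N₁ → J N₁ N₂ * (I N₃ * Θ L N₁ N₂ N₃)
    index : ∀ n₁ n₂ n₃ → n₁ ∔ n₂ ∔ n₃ ≡ n₃ ∔ n₂ ∔ n₁
    index = solveℕ
    sum-n₁ : ∀ n₂ n₃ → Σ≤ L (λ n₁ → I n₁ * (I n₂ * (I n₃ * Θ L (n₁ ∔ n₂ ∔ n₃) (n₂ ∔ n₃) n₃))) ≈ I n₂ * g n₃ (n₃ ∔ n₂)
    sum-n₁ n₂ n₃ = begin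
      Σ≤ L (λ n₁ → I n₁ * (I n₂ * (I n₃ * Θ L (n₁ ∔ n₂ ∔ n₃) (n₂ ∔ n₃) n₃)))
        ≈⟨ Σ-cong L (λ n₁ → trans (solve 3 (λ a b c → a :* (b :* c) := b :* (a :* c)) refl _ _ _)
             (*-congˡ (*-congˡ (*-congˡ (reflexive (≡.cong₂ (λ N₁ N₂ → Θ L N₁ N₂ n₃) (index n₁ n₂ n₃) (ℕ.+-comm n₂ n₃))))))) ⟩
      Σ≤ L (λ n₁ → I n₂ * (I n₁ * (I n₃ * Θ L (n₃ ∔ n₂ ∔ n₁) (n₃ ∔ n₂) n₃)))
        ≈⟨ Σ-*ˡ L _ _ ⟩
      I n₂ * Σ≤ L (λ n₁ → I n₁ * (I n₃ * Θ L (n₃ ∔ n₂ ∔ n₁) (n₃ ∔ n₂) n₃))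
        ≈⟨ *-congˡ (Σ-J L (n₃ ∔ n₂) _ (λ N₁ L<N₁ → *0 (*0 (reflexive (J-<
             (ℕ.<-≤-trans L<N₁ (ℕ.≤-trans (ℕ.m≤m+n N₁ (n₃ ∔ n₂)) (ℕ.m≤m+n (N₁ ∔ (n₃ ∔ n₂)) n₃)))))))) ⟨
      I n₂ * g n₃ (n₃ ∔ n₂) ∎

  -- The multisum from the inside out, for D = L - N₁: this is the sum over N₃ with N = N₂, and `β₂`
  -- is the sum over N₂ with N = N₁.
  β₁ : ℕ → ℕ → ℕ → Carrier
  β₁ n D N = Σ≤ n (λ r → pw (r ∙ r) * (J D (N ∔ r) * J N r) * I r)

  β₂ : ℕ → ℕ → ℕ → Carrier
  β₂ n D N = P D * I (D ∔ D) * Σ≤ n (λ r → pw (r ∙ r) * (P (N ∔ D ∔ D ∸ r) * J N r) * β₁ n D r)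

  β₁-expand : ∀ n D N → D ≤ n →
    Σ≤ n (λ l → α l * (pw (l ∙ l) * (pw (l ∙ l) * (P D * (J D (N ∔ l) * J (D ∔ l) N) * K N l)))) ≈ β₁ n D N
  β₁-expand n D N D≤n = sym (bailey-transform n α _ I _ (λ r l → pw (l ∙ l) * K r l) (α-first n)
    (λ l → bailey-second n D N l D≤n))

  β₂-expand : ∀ n D N → D ≤ n → N ≤ n →
    Σ≤ n (λ l → α l * (pw (l ∙ l) * (pw (l ∙ l) * (pw (l ∙ l)
        * (P (N ∔ D ∸ l) * P (N ∔ D ∔ l) * (K N l * K D (l ∔ l))))))) ≈ β₂ n D N
  β₂-expand n D N D≤n N≤n = begin
    Σ≤ n (λ l → α l * (pw (l ∙ l) * (pw (l ∙ l) * (pw (l ∙ l)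
        * (P (N ∔ D ∸ l) * P (N ∔ D ∔ l) * (K N l * K D (l ∔ l)))))))
      ≈⟨ Σ-cong n (λ l → *-congˡ (bailey-third n N D l N≤n)) ⟨
    Σ≤ n (λ l → α l * (P D * I (D ∔ D) * G l))
      ≈⟨ Σ-cong n (λ l → solve 3 (λ a b c → a :* (b :* c) := b :* (a :* c)) refl _ _ _) ⟩
    Σ≤ n (λ l → P D * I (D ∔ D) * (α l * G l))
      ≈⟨ Σ-*ˡ n _ _ ⟩
    P D * I (D ∔ D) * Σ≤ n (λ l → α l * G l)
      ≈⟨ *-congˡ (bailey-transform n α F (β₁ n D) G k (λ r _ → β₁-expand n D r D≤n) (λ l → refl)) ⟨
    β₂ n D N ∎
    where
    F : ℕ → Carrier
    F r = pw (r ∙ r) * (P (N ∔ D ∔ D ∸ r) * J N r)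
    k : ℕ → ℕ → Carrier
    k r l = pw (l ∙ l) * (pw (l ∙ l) * (P D * (J D (r ∔ l) * J (D ∔ l) r) * K r l))
    G : ℕ → Carrier
    G l = Σ≤ n (λ r → F r * k r l)

  Σ-β₂ : ∀ L → Σ≤ L (λ N → pw (N ∙ N) * β₂ L (L ∸ N) N)
    ≈ Σ≤ L (λ l → α l * (pw (l ∙ l) * (pw (l ∙ l) * (pw (l ∙ l) * (pw (l ∙ l) * (P (L ∔ L) * K L (l ∔ l ∔ l)))))))
  Σ-β₂ L = bailey-transform L α (λ N → pw (N ∙ N)) _ _ k
    (λ N N≤L → trans
      -- For D = L - N the index N + D is L, so these numerators do not depend on the summation
      -- variable N.
      (Σ-cong L (λ l → *-congˡ (*-congˡ (*-congˡ (*-congˡ (*-congʳ (reflexive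
        (≡.cong (λ M → P (M ∸ l) * P (M ∔ l)) (≡.sym (ℕ.m+[n∸m]≡n N≤L))))))))))
      (β₂-expand L (L ∸ N) N (ℕ.m∸n≤m L N) N≤L))
    (λ l → trans
      (Σ-cong L (λ N → solve 3 (λ a e x → a :* (e :* (e :* (e :* x))) := (e :* e :* e) :* (a :* x)) refl _ (pw (l ∙ l)) _))
      (trans (Σ-*ˡ L _ _) (trans (*-congˡ (bailey-fourth L l))
        (solve 2 (λ e x → e :* e :* e :* x := e :* (e :* (e :* x))) refl (pw (l ∙ l)) _))))
    where
    k : ℕ → ℕ → Carrier
    k N l = pw (l ∙ l) * (pw (l ∙ l) * (pw (l ∙ l) * (P (L ∸ l) * P (L ∔ l) * (K N l * K (L ∸ N) (l ∔ l)))))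

  Σ-Θ : ∀ L N₁ → N₁ ≤ L →
    Σ≤ L (λ N₂ → Σ≤ L λ N₃ → J N₂ N₃ * (J N₁ N₂ * (I N₃ * Θ L N₁ N₂ N₃))) ≈ pw (N₁ ∙ N₁) * β₂ L (L ∸ N₁) N₁
  Σ-Θ L N₁ N₁≤L = begin
    Σ≤ L (λ N₂ → Σ≤ L λ N₃ → J N₂ N₃ * (J N₁ N₂ * (I N₃ * Θ L N₁ N₂ N₃)))
      ≈⟨ Σ-cong L (λ N₂ → Σ-cong L (λ N₃ → term N₂ N₃)) ⟩
    Σ≤ L (λ N₂ → Σ≤ L λ N₃ → A * (B N₂ * C N₂ N₃))
      ≈⟨ Σ-cong L (λ N₂ → trans (Σ-*ˡ L _ _) (*-congˡ (Σ-*ˡ L _ _))) ⟩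
    Σ≤ L (λ N₂ → A * (B N₂ * β₁ L D N₂))
      ≈⟨ trans (Σ-*ˡ L _ _) (*-assoc _ _ _) ⟩
    pw (N₁ ∙ N₁) * β₂ L D N₁ ∎
    where
    D = L ∸ N₁
    A = pw (N₁ ∙ N₁) * (P D * I (D ∔ D))
    B : ℕ → Carrier
    B N₂ = pw (N₂ ∙ N₂) * (P (N₁ ∔ D ∔ D ∸ N₂) * J N₁ N₂)
    C : ℕ → ℕ → Carrier
    C N₂ N₃ = pw (N₃ ∙ N₃) * (J D (N₂ ∔ N₃) * J N₂ N₃) * I N₃
    L≡ : N₁ ∔ D ≡ L
    L≡ = ℕ.m+[n∸m]≡n N₁≤L
    -- Hence (q;q)_(2L-N₁-N₂) is exactly the numerator that balances the sum over N₂.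
    2L≡ : L ∔ L ∸ N₁ ≡ N₁ ∔ D ∔ D
    2L≡ = ≡.trans (ℕ.+-∸-assoc L N₁≤L) (≡.cong (_∔ D) (≡.sym L≡))
    term : ∀ N₂ N₃ → J N₂ N₃ * (J N₁ N₂ * (I N₃ * Θ L N₁ N₂ N₃)) ≈ A * (B N₂ * C N₂ N₃)
    term N₂ N₃ = begin
      J N₂ N₃ * (J N₁ N₂ * (I N₃ * Θ L N₁ N₂ N₃))
        ≈⟨ *-congˡ (*-congˡ (*-congˡ (*-cong (*-congʳ (*-cong (*-congʳ (trans (pw-+ _ (N₃ ∙ N₃)) (*-congʳ (pw-+ _ _))))
             (reflexive (≡.cong (λ z → P (z ∸ N₂)) 2L≡))))
             (reflexive (≡.trans (≡.cong₂ J (≡.sym L≡) (ℕ.+-assoc N₁ N₂ N₃)) (J-+ N₁ D (N₂ ∔ N₃))))))) ⟩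
      J N₂ N₃ * (J N₁ N₂ * (I N₃ * (pw (N₁ ∙ N₁) * pw (N₂ ∙ N₂) * pw (N₃ ∙ N₃) * P D * P (N₁ ∔ D ∔ D ∸ N₂)
         * I (D ∔ D) * J D (N₂ ∔ N₃))))
        ≈⟨ solve 10 (λ j₂ j₁ i a b c p p′ i₂ j → j₂ :* (j₁ :* (i :* (a :* b :* c :* p :* p′ :* i₂ :* j)))
             := a :* (p :* i₂) :* (b :* (p′ :* j₁) :* (c :* (j :* j₂) :* i))) refl _ _ _ _ _ _ _ _ _ _ ⟩
      A * (B N₂ * C N₂ N₃) ∎

  multisum : ∀ L →
    Σ≤ L (λ n₁ → Σ≤ L λ n₂ → Σ≤ L λ n₃ → I n₁ * (I n₂ * (I n₃ * Θ L (n₁ ∔ n₂ ∔ n₃) (n₂ ∔ n₃) n₃)))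
      ≈ Σ≤ L (λ l → α l * (pw (l ∙ l) * (pw (l ∙ l) * (pw (l ∙ l) * (pw (l ∙ l) * (P (L ∔ L) * K L (l ∔ l ∔ l)))))))
  multisum L = trans (Σ-partial-sums L) (trans (Σ-cong≤ L (Σ-Θ L)) (Σ-β₂ L))

  -- The Borwein product

  -- w n a is the elementary symmetric polynomial of degree a in 1, q, …, q^(n-1).
  w : ℕ → ℕ → Carrier
  w n       zero    = 1#
  w zero    (suc a) = 0#
  w (suc n) (suc a) = w n (suc a) + pw n * w n a

  -- The q-binomial theorem, w n a = q^(a(a-1)/2) [n, a], proved by the q-Pascal rule.
  w-closed : ∀ n a → w n a ≈ pw (tri a) * (P n * I a * J n a)
  w-closed n zero = sym (begin
    pw 0 * (P n * 1# * I n)   ≈⟨ *-cong pw-0 (*-congʳ (*-identityʳ _)) ⟩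
    1# * (P n * I n)          ≈⟨ *-congˡ (P*I n) ⟩
    1# * 1#                   ≈⟨ *-identityˡ 1# ⟩
    1#                        ∎)
  w-closed zero    (suc a) = sym (*0 (zeroʳ _))
  w-closed (suc n) (suc a) = begin
    w n (suc a) + pw n * w n a
      ≈⟨ +-cong (w-closed n (suc a)) (*-congˡ (w-closed n a)) ⟩
    pw (a ∔ tri a) * (P n * I (suc a) * J n (suc a)) + pw n * (pw (tri a) * (P n * I a * J n a))
      ≈⟨ +-cong (*-congʳ (pw-+ a (tri a))) (*-congˡ (*-congˡ (*-congʳ (*-congˡ (sym (I-suc a)))))) ⟩
    pw a * pw (tri a) * (P n * I (suc a) * J n (suc a)) + pw n * (pw (tri a) * (P n * ((1# - pw (suc a)) * I (suc a)) * J n a))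
      ≈⟨ solve 8 (λ a t p i j n s j′ → a :* t :* (p :* i :* j) :+ n :* (t :* (p :* ((𝟙 :- s) :* i) :* j′))
           := t :* p :* i :* (a :* j :+ (n :- n :* s) :* j′)) refl _ _ _ _ _ _ _ _ ⟩
    pw (tri a) * P n * I (suc a) * (pw a * J n (suc a) + (pw n - pw n * pw (suc a)) * J n a)
      ≈⟨ *-congˡ (+-cong (J-pw n a) (*-congʳ (+-congˡ (-‿cong pw-suc)))) ⟨
    pw (tri a) * P n * I (suc a) * ((pw a - pw n) * J n a + (pw n - pw a * pw (suc n)) * J n a)
      -- Here (q^a - q^n) + (q^n - q^(a+n+1)) = q^a (1 - q^(n+1)).
      ≈⟨ solve 7 (λ t p i a n j s → t :* p :* i :* ((a :- n) :* j :+ (n :- a :* s) :* j)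
           := a :* t :* (p :* (𝟙 :- s) :* i :* j)) refl _ _ _ _ _ _ _ ⟩
    pw a * pw (tri a) * (P n * (1# - pw (suc n)) * I (suc a) * J n a)
      ≈⟨ *-congʳ (pw-+ a (tri a)) ⟨
    pw (tri (suc a)) * (P (suc n) * I (suc a) * J (suc n) (suc a)) ∎
    where
    pw-suc : pw a * pw (suc n) ≈ pw n * pw (suc a)
    pw-suc = trans (sym (pw-+ a (suc n))) (trans (pw-≡ (eq a n)) (pw-+ n (suc a)))
      where
      eq : ∀ a n → a ∔ suc n ≡ n ∔ suc a
      eq = solveℕ

  w-< : ∀ {n a} → n < a → w n a ≈ 0#
  w-< {n} {a} n<a = trans (w-closed n a) (*0 (*0 (reflexive (J-< n<a))))

  -- The exponents add up to j(j-1)/2 + b(b+j), so this is `vandermonde` at x = n - j, y = n, c = j.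
  -- The right side is q^(j(j-1)/2) [2n, n+j].
  Σ-w : ∀ n j → Σ≤ n (λ b → pw b * (w n (b ∔ j) * w n b)) ≈ pw (tri j) * (P (n ∔ n) * K n j)
  Σ-w n j with offset j n
  ... | inj₂ n<j = trans (Σ-zero n (λ b → *0 (0* (w-< (ℕ.<-≤-trans n<j (ℕ.m≤n+m j b)))))) (sym (*0 (*0 (K-< n<j))))
  ... | inj₁ (r , ≡.refl) = begin
    Σ≤ n (λ b → pw b * (w n (b ∔ j) * w n b))
      ≈⟨ Σ-cong n term ⟩
    Σ≤ n (λ b → pw (tri j) * (P n * P n) * (pw (b ∙ (b ∔ j)) * I b * I (b ∔ j) * J r b * J n b))
      ≈⟨ Σ-*ˡ n _ _ ⟩
    pw (tri j) * (P n * P n) * Σ≤ n (λ b → pw (b ∙ (b ∔ j)) * I b * I (b ∔ j) * J r b * J n b)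
      ≈⟨ *-congˡ (vandermonde n j n r (ℕ.m≤n+m r j)) ⟩
    pw (tri j) * (P n * P n) * (P (r ∔ n ∔ j) * (I r * I n * (I (r ∔ j) * I (n ∔ j))))
      ≈⟨ *-congˡ (*-cong (reflexive (≡.cong P (index j r))) (*-congˡ (*-congʳ (reflexive (≡.cong I (ℕ.+-comm r j)))))) ⟩
    pw (tri j) * (P n * P n) * (P (n ∔ n) * (I r * I n * (I n * I (n ∔ j))))
      ≈⟨ solve 6 (λ t p p₂ i i′ k → t :* (p :* p) :* (p₂ :* (i :* i′ :* (i′ :* k)))
           := p :* i′ :* (p :* i′) :* (t :* (p₂ :* (i :* k)))) refl _ (P n) _ _ (I n) _ ⟩
    P n * I n * (P n * I n) * (pw (tri j) * (P (n ∔ n) * (I r * I (n ∔ j))))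
      ≈⟨ *-cong (*-cong (P*I n) (P*I n)) (*-congˡ (*-congˡ (*-congʳ (reflexive (≡.sym (J-offset j r)))))) ⟩
    1# * 1# * (pw (tri j) * (P (n ∔ n) * K n j))
      ≈⟨ solve 1 (λ x → 𝟙 :* 𝟙 :* x := x) refl _ ⟩
    pw (tri j) * (P (n ∔ n) * K n j) ∎
    where
    index : ∀ j r → r ∔ (j ∔ r) ∔ j ≡ j ∔ r ∔ (j ∔ r)
    index = solveℕ
    exponent : ∀ b → b ∔ tri (b ∔ j) ∔ tri b ≡ tri j ∔ b ∙ (b ∔ j)
    exponent b = ≡.trans (≡.cong (λ z → b ∔ z ∔ tri b) (tri-+ b j))
      (≡.trans (lemma₁ b j (tri b) (tri j)) (≡.trans (≡.cong (λ z → tri j ∔ (z ∔ b ∙ j)) (tri-double b)) (lemma₂ b j (tri j))))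
      where
      lemma₁ : ∀ b j x y → b ∔ (x ∔ y ∔ b ∙ j) ∔ x ≡ y ∔ (x ∔ x ∔ b ∔ b ∙ j)
      lemma₁ = solveℕ
      lemma₂ : ∀ b j y → y ∔ (b ∙ b ∔ b ∙ j) ≡ y ∔ b ∙ (b ∔ j)
      lemma₂ = solveℕ
    term : ∀ b → pw b * (w n (b ∔ j) * w n b)
      ≈ pw (tri j) * (P n * P n) * (pw (b ∙ (b ∔ j)) * I b * I (b ∔ j) * J r b * J n b)
    term b = begin
      pw b * (w n (b ∔ j) * w n b)
        ≈⟨ *-congˡ (*-cong (w-closed n (b ∔ j)) (w-closed n b)) ⟩
      pw b * (pw (tri (b ∔ j)) * (P n * I (b ∔ j) * J n (b ∔ j)) * (pw (tri b) * (P n * I b * J n b)))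
        ≈⟨ *-congˡ (*-congʳ (*-congˡ (*-congˡ (reflexive (≡.trans (≡.cong (J n) (ℕ.+-comm b j)) (J-+ j r b)))))) ⟩
      pw b * (pw (tri (b ∔ j)) * (P n * I (b ∔ j) * J r b) * (pw (tri b) * (P n * I b * J n b)))
        ≈⟨ solve 8 (λ a t p i j s k l → a :* (t :* (p :* i :* j) :* (s :* (p :* k :* l)))
             := (a :* t :* s) :* (p :* p :* (k :* i :* j :* l))) refl _ _ (P n) _ _ _ _ _ ⟩
      pw b * pw (tri (b ∔ j)) * pw (tri b) * (P n * P n * (I b * I (b ∔ j) * J r b * J n b))
        ≈⟨ *-congʳ (trans (sym (trans (pw-+ _ (tri b)) (*-congʳ (pw-+ b _)))) (trans (pw-≡ (exponent b)) (pw-+ (tri j) _))) ⟩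
      pw (tri j) * pw (b ∙ (b ∔ j)) * (P n * P n * (I b * I (b ∔ j) * J r b * J n b))
        ≈⟨ solve 7 (λ t s p i k j l → t :* s :* (p :* (i :* k :* j :* l)) := t :* p :* (s :* i :* k :* j :* l)) refl _ _ _ _ _ _ _ ⟩
      pw (tri j) * (P n * P n) * (pw (b ∙ (b ∔ j)) * I b * I (b ∔ j) * J r b * J n b) ∎

  -- Sums along diagonals and in steps of three

  diagonals : (ℕ → ℕ → Carrier) → ℕ → ℕ → Carrier
  diagonals F n zero    = Σ≤ n (λ b → F b b)
  diagonals F n (suc j) = Σ≤ n (λ b → F (b ∔ suc j) b + F b (b ∔ suc j))

  -- Induction by removing row 0 and column 0: they supply the b = 0 terms of all diagonals, and the
  -- rest is the same sum for the shifted F.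
  Σ-diagonals : ∀ n (F : ℕ → ℕ → Carrier) →
    (∀ i j → n < i → F i j ≈ 0#) → (∀ i j → n < j → F i j ≈ 0#) →
    Σ≤ n (λ i → Σ≤ n (F i)) ≈ Σ≤ n (diagonals F n)
  Σ-diagonals zero    F F0 F0′ = refl
  Σ-diagonals (suc n) F F0 F0′ = begin
    Σ≤ (suc n) (λ i → Σ≤ (suc n) (F i))
      ≈⟨ Σ-head n _ ⟩
    Σ≤ (suc n) (F 0) + Σ≤ n (λ i → Σ≤ (suc n) (F (suc i)))
      ≈⟨ +-cong (Σ-head n _) (trans (Σ-cong n (λ i → Σ-head n _)) (Σ-+ n _ _)) ⟩
    (F 0 0 + row) + (column + Σ≤ n (λ i → Σ≤ n (F′ i)))
      ≈⟨ +-congˡ (+-congˡ (Σ-diagonals n F′ (λ i j n<i → F0 (suc i) (suc j) (s<s n<i)) (λ i j n<j → F0′ (suc i) (suc j) (s<s n<j)))) ⟩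
    (F 0 0 + row) + (column + Σ≤ n (diagonals F′ n))
      -- The vanishing diagonal suc n is appended, so that after removing diagonal 0 as many remain
      -- as there are entries in the row and in the column.
      ≈⟨ +-congˡ (+-congˡ (trans (sym (+-identityʳ _)) (trans (+-congˡ (sym last)) (Σ-head n _)))) ⟩
    (F 0 0 + row) + (column + (diagonals F′ n 0 + Σ≤ n (λ j → diagonals F′ n (suc j))))
      ≈⟨ solve 5 (λ a b c d e → (a :+ b) :+ (c :+ (d :+ e)) := (a :+ d) :+ ((c :+ b) :+ e)) refl _ _ _ _ _ ⟩
    (F 0 0 + diagonals F′ n 0) + ((column + row) + Σ≤ n (λ j → diagonals F′ n (suc j)))
      ≈⟨ +-cong (Σ-head n _) (trans (Σ-cong n (λ j → Σ-head n _)) (trans (Σ-+ n _ _) (+-congʳ (Σ-+ n _ _)))) ⟨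
    diagonals F (suc n) 0 + Σ≤ n (λ j → diagonals F (suc n) (suc j))
      ≈⟨ Σ-head n _ ⟨
    Σ≤ (suc n) (diagonals F (suc n)) ∎
    where
    F′ : ℕ → ℕ → Carrier
    F′ i j = F (suc i) (suc j)
    row    = Σ≤ n (λ j → F 0 (suc j))
    column = Σ≤ n (λ i → F (suc i) 0)
    last : diagonals F′ n (suc n) ≈ 0#
    last = Σ-zero n (λ b → trans
      (+-cong (F0 _ _ (s<s (ℕ.m≤n+m (suc n) b))) (F0′ _ _ (s<s (ℕ.m≤n+m (suc n) b)))) (+-identityˡ 0#))

  Σ-thirds : ∀ n (g : ℕ → Carrier) → (∀ i → n < i → g i ≈ 0#) →
    (∀ l → g (suc (l ∙ 3)) ≈ 0#) → (∀ l → g (suc (suc (l ∙ 3))) ≈ 0#) →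
    Σ≤ n g ≈ Σ≤ n (λ l → g (l ∙ 3))
  Σ-thirds n g g0 g1 g2 = begin
    -- Padding with 2n + 2 zeros gives the range 0..3n+2, which consists of n + 1 blocks of three.
    Σ≤ n g                       ≈⟨ Σ-extend (suc (suc (n ∔ n))) n g g0 ⟨
    Σ≤ (suc (suc (n ∔ n)) ∔ n) g ≡⟨ ≡.cong (λ m → Σ≤ m g) (eq n) ⟩
    Σ≤ (suc (suc (n ∙ 3))) g     ≈⟨ drop n ⟩
    Σ≤ n (λ l → g (l ∙ 3))       ∎
    where
    eq : ∀ n → suc (suc (n ∔ n)) ∔ n ≡ suc (suc (n ∙ 3))
    eq = solveℕ
    drop : ∀ n → Σ≤ (suc (suc (n ∙ 3))) g ≈ Σ≤ n (λ l → g (l ∙ 3))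
    drop zero    = trans (+-cong (trans (+-congˡ (g1 0)) (+-identityʳ _)) (g2 0)) (+-identityʳ _)
    drop (suc n) = trans (+-cong (trans (+-cong (+-congʳ (drop n)) (g1 (suc n))) (+-identityʳ _)) (g2 (suc n))) (+-identityʳ _)

  σ-+ : ∀ b j → σ (b ∔ j) * σ b ≈ σ j
  σ-+ zero    j = *-identityʳ _
  σ-+ (suc b) j = trans (solve 2 (λ a b → :- a :* :- b := a :* b) refl _ _) (σ-+ b j)

  σ-triple : ∀ l → σ (l ∙ 3) ≈ σ l
  σ-triple zero    = refl
  σ-triple (suc l) = trans (solve 1 (λ a → :- :- :- a := :- a) refl _) (-‿cong (σ-triple l))

  -- Trisection of the Borwein product

  Poch : ℕ → ℕ → ℕ → Carrier
  Poch a d zero    = 1#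
  Poch a d (suc n) = Poch a d n * (1# - pw (a ∔ d ∙ n))

  Poch-P : ∀ n → Poch 1 1 n ≈ P n
  Poch-P zero    = refl
  Poch-P (suc n) = *-cong (Poch-P n) (+-congˡ (-‿cong (pw-≡ (≡.cong suc (ℕ.*-identityˡ n)))))

  -- In the application, φ f (q) = f (q³) and ψ extracts the exponents divisible by 3.
  module Trisection (φ ψ : Carrier → Carrier)
    (φ-cong : ∀ {x y} → x ≈ y → φ x ≈ φ y)
    (φ-+ : ∀ x y → φ (x + y) ≈ φ x + φ y) (φ-neg : ∀ x → φ (- x) ≈ - φ x)
    (φ-0 : φ 0# ≈ 0#) (φ-1 : φ 1# ≈ 1#) (φ-pw-* : ∀ n x → φ (pw n * x) ≈ pw (n ∙ 3) * φ x)
    (ψ-cong : ∀ {x y} → x ≈ y → ψ x ≈ ψ y)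
    (ψ-+ : ∀ x y → ψ (x + y) ≈ ψ x + ψ y) (ψ-φ-* : ∀ x y → ψ (φ x * y) ≈ x * ψ y)
    (θ0 : ψ (pw 0) ≈ 1#) (θ1 : ψ (pw 1) ≈ 0#) (θ2 : ψ (pw 2) ≈ 0#)
    (θ3+ : ∀ n → ψ (pw (3 ∔ n)) ≈ pw 1 * ψ (pw n)) where

    -- q^(n/3) if 3 divides n, and 0 otherwise.
    θ : ℕ → Carrier
    θ n = ψ (pw n)

    -- Expansion of the product of the 1 - q^(a+3i) in elementary symmetric polynomials of 1, q³,
    -- ...; the recursion for `w` is multiplication by one more factor.
    q-binomial : ∀ a n → Poch a 3 n ≈ Σ≤ n (λ i → σ i * (pw (i ∙ a) * φ (w n i)))
    q-binomial a zero = sym (begin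
      1# * (pw 0 * φ 1#)   ≈⟨ *-identityˡ _ ⟩
      pw 0 * φ 1#          ≈⟨ *-cong pw-0 φ-1 ⟩
      1# * 1#                ≈⟨ *-identityˡ 1# ⟩
      1#                     ∎)
    q-binomial a (suc n) = begin
      Poch a 3 n * (1# - x)
        ≈⟨ *-congʳ (q-binomial a n) ⟩
      Σ≤ n (W n) * (1# - x)
        ≈⟨ solve 2 (λ s x → s :* (𝟙 :- x) := s :+ (:- x) :* s) refl _ x ⟩
      Σ≤ n (W n) + - x * Σ≤ n (W n)
        ≈⟨ +-congʳ (trans (sym (+-identityʳ _)) (trans (+-congˡ (sym W-last)) (Σ-head n (W n)))) ⟩
      (W n 0 + Σ≤ n (λ i → W n (suc i))) + - x * Σ≤ n (W n)
        ≈⟨ trans (+-assoc _ _ _) (+-congˡ (trans (+-congˡ (sym (Σ-*ˡ n _ _))) (sym (Σ-+ n _ _)))) ⟩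
      W n 0 + Σ≤ n (λ i → W n (suc i) + - x * W n i)
        ≈⟨ +-congˡ (Σ-cong n W-suc) ⟨
      W (suc n) 0 + Σ≤ n (λ i → W (suc n) (suc i))
        ≈⟨ Σ-head n (W (suc n)) ⟨
      Σ≤ (suc n) (W (suc n)) ∎
      where
      x = pw (a ∔ 3 ∙ n)
      W : ℕ → ℕ → Carrier
      W n i = σ i * (pw (i ∙ a) * φ (w n i))
      W-last : W n (suc n) ≈ 0#
      W-last = *0 (*0 (trans (φ-cong (w-< (ℕ.n<1+n n))) φ-0))
      W-suc : ∀ i → W (suc n) (suc i) ≈ W n (suc i) + - x * W n i
      W-suc i = begin
        - σ i * (pw (a ∔ i ∙ a) * φ (w n (suc i) + pw n * w n i))
          ≈⟨ *-congˡ (*-cong (pw-+ a (i ∙ a)) (trans (φ-+ _ _) (+-congˡ (φ-pw-* n (w n i))))) ⟩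
        - σ i * (pw a * pw (i ∙ a) * (φ (w n (suc i)) + pw (n ∙ 3) * φ (w n i)))
          ≈⟨ solve 6 (λ s a i u n v → :- s :* (a :* i :* (u :+ n :* v)) := :- s :* (a :* i :* u) :+ :- (a :* n) :* (s :* (i :* v))) refl _ _ _ _ _ _ ⟩
        - σ i * (pw a * pw (i ∙ a) * φ (w n (suc i))) + - (pw a * pw (n ∙ 3)) * (σ i * (pw (i ∙ a) * φ (w n i)))
          ≈⟨ +-cong (*-congˡ (*-congʳ (pw-+ a (i ∙ a))))
               (*-congʳ (-‿cong (trans (pw-≡ (≡.cong (a ∔_) (ℕ.*-comm 3 n))) (pw-+ a (n ∙ 3))))) ⟨
        W n (suc i) + - x * W n i ∎

    σ-φ : ∀ n → σ n ≈ φ (σ n)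
    σ-φ zero    = sym φ-1
    σ-φ (suc n) = trans (-‿cong (σ-φ n)) (sym (φ-neg (σ n)))

    ψ-σ-* : ∀ n f → ψ (σ n * f) ≈ σ n * ψ f
    ψ-σ-* n f = trans (ψ-cong (*-congʳ (σ-φ n))) (ψ-φ-* (σ n) f)

    ψ-Σ : ∀ n (f : ℕ → Carrier) → ψ (Σ≤ n f) ≈ Σ≤ n (λ i → ψ (f i))
    ψ-Σ zero    f = refl
    ψ-Σ (suc n) f = trans (ψ-+ _ _) (+-congʳ (ψ-Σ n f))

    -- Apart from the monomial q^(i+2j), each term consists of signs and values of φ, which can be
    -- taken out of ψ; the trisection then acts on a monomial alone.
    ψ-Poch : ∀ L → ψ (Poch 1 3 L * Poch 2 3 L)
      ≈ Σ≤ L (λ i → Σ≤ L λ j → σ i * w L i * (σ j * w L j) * θ (i ∔ (j ∔ j)))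
    ψ-Poch L = begin
      ψ (Poch 1 3 L * Poch 2 3 L)
        ≈⟨ ψ-cong (*-cong (q-binomial 1 L) (q-binomial 2 L)) ⟩
      ψ (Σ≤ L (W 1) * Σ≤ L (W 2))
        ≈⟨ ψ-cong (Σ-*-Σ L L (W 1) (W 2)) ⟩
      ψ (Σ≤ L (λ i → Σ≤ L λ j → W 1 i * W 2 j))
        ≈⟨ trans (ψ-Σ L (λ i → Σ≤ L λ j → W 1 i * W 2 j)) (Σ-cong L (λ i → ψ-Σ L (λ j → W 1 i * W 2 j))) ⟩
      Σ≤ L (λ i → Σ≤ L λ j → ψ (W 1 i * W 2 j))
        ≈⟨ Σ-cong L (λ i → Σ-cong L (term i)) ⟩
      Σ≤ L (λ i → Σ≤ L λ j → σ i * w L i * (σ j * w L j) * θ (i ∔ (j ∔ j))) ∎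
      where
      W : ℕ → ℕ → Carrier
      W a i = σ i * (pw (i ∙ a) * φ (w L i))
      exponent : ∀ i j → i ∙ 1 ∔ j ∙ 2 ≡ i ∔ (j ∔ j)
      exponent = solveℕ
      term : ∀ i j → ψ (W 1 i * W 2 j) ≈ σ i * w L i * (σ j * w L j) * θ (i ∔ (j ∔ j))
      term i j = begin
        ψ (W 1 i * W 2 j)
          ≈⟨ ψ-cong (solve 6 (λ s p v s′ p′ v′ → s :* (p :* v) :* (s′ :* (p′ :* v′)) := s :* (v :* (s′ :* (v′ :* (p :* p′)))))
               refl (σ i) (pw (i ∙ 1)) (φ (w L i)) (σ j) (pw (j ∙ 2)) (φ (w L j))) ⟩
        ψ (σ i * (φ (w L i) * (σ j * (φ (w L j) * (pw (i ∙ 1) * pw (j ∙ 2))))))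
          ≈⟨ trans (ψ-σ-* i _) (*-congˡ (trans (ψ-φ-* (w L i) _) (*-congˡ (trans (ψ-σ-* j _) (*-congˡ (ψ-φ-* (w L j) _)))))) ⟩
        σ i * (w L i * (σ j * (w L j * ψ (pw (i ∙ 1) * pw (j ∙ 2)))))
          ≈⟨ *-congˡ (*-congˡ (*-congˡ (*-congˡ (ψ-cong (trans (sym (pw-+ (i ∙ 1) (j ∙ 2))) (pw-≡ (exponent i j))))))) ⟩
        σ i * (w L i * (σ j * (w L j * θ (i ∔ (j ∔ j)))))
          ≈⟨ solve 5 (λ s v s′ v′ t → s :* (v :* (s′ :* (v′ :* t))) := s :* v :* (s′ :* v′) :* t) refl (σ i) (w L i) (σ j) (w L j) (θ (i ∔ (j ∔ j))) ⟩
        σ i * w L i * (σ j * w L j) * θ (i ∔ (j ∔ j)) ∎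

    θ-+ : ∀ b n → θ (b ∙ 3 ∔ n) ≈ pw b * θ n
    θ-+ zero    n = sym (trans (*-congʳ pw-0) (*-identityˡ _))
    θ-+ (suc b) n = begin
      θ (3 ∔ (b ∙ 3 ∔ n))      ≈⟨ θ3+ _ ⟩
      pw 1 * θ (b ∙ 3 ∔ n)     ≈⟨ *-congˡ (θ-+ b n) ⟩
      pw 1 * (pw b * θ n)      ≈⟨ *-assoc _ _ _ ⟨
      pw 1 * pw b * θ n        ≈⟨ *-congʳ (pw-+ 1 b) ⟨
      pw (suc b) * θ n         ∎

    -- The weight of the two diagonals at distance j: on them the exponents of q are 3b + j and 3b +
    -- 2j.
    γ : ℕ → Carrier
    γ zero    = 1#
    γ (suc j) = σ (suc j) * (θ (suc j) + θ (suc j ∔ suc j))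

    γ-zero : ∀ j → θ (suc j) ≈ 0# → θ (suc j ∔ suc j) ≈ 0# → γ (suc j) ≈ 0#
    γ-zero j e e′ = *0 (trans (+-cong e e′) (+-identityˡ 0#))

    γ1 : ∀ l → γ (suc (l ∙ 3)) ≈ 0#
    γ1 l = γ-zero (l ∙ 3)
      (trans (reflexive (≡.cong θ (eq l))) (trans (θ-+ l 1) (*0 θ1)))
      (trans (reflexive (≡.cong θ (eq′ l))) (trans (θ-+ (l ∔ l) 2) (*0 θ2)))
      where
      eq : ∀ l → suc (l ∙ 3) ≡ l ∙ 3 ∔ 1
      eq = solveℕ
      eq′ : ∀ l → suc (l ∙ 3) ∔ suc (l ∙ 3) ≡ (l ∔ l) ∙ 3 ∔ 2
      eq′ = solveℕ

    γ2 : ∀ l → γ (suc (suc (l ∙ 3))) ≈ 0#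
    γ2 l = γ-zero (suc (l ∙ 3))
      (trans (reflexive (≡.cong θ (eq l))) (trans (θ-+ l 2) (*0 θ2)))
      (trans (reflexive (≡.cong θ (eq′ l))) (trans (θ-+ (suc (l ∔ l)) 1) (*0 θ1)))
      where
      eq : ∀ l → suc (suc (l ∙ 3)) ≡ l ∙ 3 ∔ 2
      eq = solveℕ
      eq′ : ∀ l → suc (suc (l ∙ 3)) ∔ suc (suc (l ∙ 3)) ≡ suc (l ∔ l) ∙ 3 ∔ 1
      eq′ = solveℕ

    -- As θ(3l) + θ(6l) = q^l (1 + q^l), one q^l is left over from α, and `tri-triple` absorbs it.
    γ-triple : ∀ l x → γ (l ∙ 3) * (pw (tri (l ∙ 3)) * x)
      ≈ α l * (pw (l ∙ l) * (pw (l ∙ l) * (pw (l ∙ l) * (pw (l ∙ l) * x))))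
    γ-triple zero x = begin
      1# * (pw 0 * x)                                     ≈⟨ *-congˡ (*-congʳ pw-0) ⟩
      1# * (1# * x)                                       ≈⟨ solve 1 (λ x → 𝟙 :* (𝟙 :* x) := 𝟙 :* (𝟙 :* (𝟙 :* (𝟙 :* (𝟙 :* x))))) refl x ⟩
      1# * (1# * (1# * (1# * (1# * x))))                  ≈⟨ *-congˡ (*-cong pw-0 (*-cong pw-0 (*-cong pw-0 (*-congʳ pw-0)))) ⟨
      1# * (pw 0 * (pw 0 * (pw 0 * (pw 0 * x))))          ∎
    γ-triple (suc m) x = begin
      σ (l ∙ 3) * (θ (l ∙ 3) + θ (l ∙ 3 ∔ l ∙ 3)) * (pw (tri (l ∙ 3)) * x)
        ≈⟨ *-congʳ (*-cong (σ-triple l) (+-cong θl θ2l)) ⟩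
      σ l * (pw l + pw l * pw l) * (pw (tri (l ∙ 3)) * x)
        ≈⟨ solve 4 (λ s p t x → s :* (p :+ p :* p) :* (t :* x) := s :* (𝟙 :+ p) :* (t :* p :* x)) refl (σ l) (pw l) _ _ ⟩
      σ l * (1# + pw l) * (pw (tri (l ∙ 3)) * pw l * x)
        ≈⟨ *-congˡ (*-congʳ exponent) ⟩
      σ l * (1# + pw l) * (pw (tri l) * (e * (e * (e * e))) * x)
        ≈⟨ solve 5 (λ s p t e x → s :* (𝟙 :+ p) :* (t :* (e :* (e :* (e :* e))) :* x)
             := s :* t :* (𝟙 :+ p) :* (e :* (e :* (e :* (e :* x))))) refl (σ l) (pw l) _ e x ⟩
      α l * (e * (e * (e * (e * x)))) ∎
      where
      l = suc m
      e = pw (l ∙ l)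
      θl : θ (l ∙ 3) ≈ pw l
      θl = trans (reflexive (≡.cong θ (≡.sym (ℕ.+-identityʳ (l ∙ 3))))) (trans (θ-+ l 0) (trans (*-congˡ θ0) (*-identityʳ _)))
      θ2l : θ (l ∙ 3 ∔ l ∙ 3) ≈ pw l * pw l
      θ2l = trans (θ-+ l (l ∙ 3)) (*-congˡ θl)
      exponent : pw (tri (l ∙ 3)) * pw l ≈ pw (tri l) * (e * (e * (e * e)))
      exponent = trans (sym (pw-+ _ l)) (trans (pw-≡ (tri-triple l))
        (trans (pw-+ _ _) (*-congˡ (trans (pw-+ _ _) (*-congˡ (trans (pw-+ _ _) (*-congˡ (pw-+ _ _))))))))

    -- Along a diagonal θ varies only by the factor q^b and the signs multiply to (-1)^j, so each
    -- diagonal is a case of `Σ-w`. Since γ vanishes off the multiples of 3, only j = 3l remains.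
    trisected-product : ∀ n →
      Σ≤ n (λ i → Σ≤ n λ j → σ i * w n i * (σ j * w n j) * θ (i ∔ (j ∔ j)))
        ≈ Σ≤ n (λ l → α l * (pw (l ∙ l) * (pw (l ∙ l) * (pw (l ∙ l) * (pw (l ∙ l) * (P (n ∔ n) * K n (l ∔ l ∔ l)))))))
    trisected-product n = begin
      Σ≤ n (λ i → Σ≤ n (F i))
        ≈⟨ Σ-diagonals n F (λ i j n<i → 0* (0* (*0 (w-< n<i)))) (λ i j n<j → 0* (*0 (*0 (w-< n<j)))) ⟩
      Σ≤ n (diagonals F n)
        ≈⟨ Σ-cong n diagonal ⟩
      Σ≤ n (λ j → γ j * (pw (tri j) * (P (n ∔ n) * K n j)))
        ≈⟨ Σ-thirds n _ (λ j n<j → *0 (*0 (*0 (K-< n<j)))) (λ l → 0* (γ1 l)) (λ l → 0* (γ2 l)) ⟩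
      Σ≤ n (λ l → γ (l ∙ 3) * (pw (tri (l ∙ 3)) * (P (n ∔ n) * K n (l ∙ 3))))
        ≈⟨ Σ-cong n (λ l → trans (γ-triple l _)
             (*-congˡ (*-congˡ (*-congˡ (*-congˡ (*-congˡ (*-congˡ (reflexive (≡.cong (K n) (triple-≡ l)))))))))) ⟩
      Σ≤ n (λ l → α l * (pw (l ∙ l) * (pw (l ∙ l) * (pw (l ∙ l) * (pw (l ∙ l) * (P (n ∔ n) * K n (l ∔ l ∔ l))))))) ∎
      where
      F : ℕ → ℕ → Carrier
      F i j = σ i * w n i * (σ j * w n j) * θ (i ∔ (j ∔ j))
      triple-≡ : ∀ l → l ∙ 3 ≡ l ∔ l ∔ l
      triple-≡ = solveℕ
      upper : ∀ b j → F (b ∔ j) b ≈ σ j * θ j * (pw b * (w n (b ∔ j) * w n b))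
      upper b j = begin
        σ (b ∔ j) * w n (b ∔ j) * (σ b * w n b) * θ (b ∔ j ∔ (b ∔ b))
          ≈⟨ *-congˡ (trans (reflexive (≡.cong θ (eq b j))) (θ-+ b j)) ⟩
        σ (b ∔ j) * w n (b ∔ j) * (σ b * w n b) * (pw b * θ j)
          ≈⟨ solve 6 (λ s v s′ v′ p t → s :* v :* (s′ :* v′) :* (p :* t) := s :* s′ :* t :* (p :* (v :* v′))) refl _ _ _ _ _ _ ⟩
        σ (b ∔ j) * σ b * θ j * (pw b * (w n (b ∔ j) * w n b))
          ≈⟨ *-congʳ (*-congʳ (σ-+ b j)) ⟩
        σ j * θ j * (pw b * (w n (b ∔ j) * w n b)) ∎
        where
        eq : ∀ b j → b ∔ j ∔ (b ∔ b) ≡ b ∙ 3 ∔ j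
        eq = solveℕ
      lower : ∀ b j → F b (b ∔ j) ≈ σ j * θ (j ∔ j) * (pw b * (w n (b ∔ j) * w n b))
      lower b j = begin
        σ b * w n b * (σ (b ∔ j) * w n (b ∔ j)) * θ (b ∔ (b ∔ j ∔ (b ∔ j)))
          ≈⟨ *-congˡ (trans (reflexive (≡.cong θ (eq b j))) (θ-+ b (j ∔ j))) ⟩
        σ b * w n b * (σ (b ∔ j) * w n (b ∔ j)) * (pw b * θ (j ∔ j))
          ≈⟨ solve 6 (λ s v s′ v′ p t → s :* v :* (s′ :* v′) :* (p :* t) := s′ :* s :* t :* (p :* (v′ :* v))) refl _ _ _ _ _ _ ⟩
        σ (b ∔ j) * σ b * θ (j ∔ j) * (pw b * (w n (b ∔ j) * w n b))
          ≈⟨ *-congʳ (*-congʳ (σ-+ b j)) ⟩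
        σ j * θ (j ∔ j) * (pw b * (w n (b ∔ j) * w n b)) ∎
        where
        eq : ∀ b j → b ∔ (b ∔ j ∔ (b ∔ j)) ≡ b ∙ 3 ∔ (j ∔ j)
        eq = solveℕ
      diagonal : ∀ j → diagonals F n j ≈ γ j * (pw (tri j) * (P (n ∔ n) * K n j))
      diagonal zero = begin
        Σ≤ n (λ b → F b b)
          ≈⟨ Σ-cong n (λ b → trans (reflexive (≡.cong (λ z → F z b) (≡.sym (ℕ.+-identityʳ b)))) (upper b 0)) ⟩
        Σ≤ n (λ b → 1# * θ 0 * (pw b * (w n (b ∔ 0) * w n b)))
          ≈⟨ Σ-*ˡ n _ _ ⟩
        1# * θ 0 * Σ≤ n (λ b → pw b * (w n (b ∔ 0) * w n b))
          ≈⟨ *-cong (trans (*-identityˡ _) θ0) (Σ-w n 0) ⟩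
        1# * (pw 0 * (P (n ∔ n) * K n 0)) ∎
      diagonal (suc j) = begin
        Σ≤ n (λ b → F (b ∔ s) b + F b (b ∔ s))
          ≈⟨ Σ-cong n (λ b → trans (+-cong (upper b s) (lower b s))
               (solve 4 (λ s t u x → s :* t :* x :+ s :* u :* x := s :* (t :+ u) :* x) refl _ _ _ _)) ⟩
        Σ≤ n (λ b → γ s * (pw b * (w n (b ∔ s) * w n b)))
          ≈⟨ Σ-*ˡ n _ _ ⟩
        γ s * Σ≤ n (λ b → pw b * (w n (b ∔ s) * w n b))
          ≈⟨ *-congˡ (Σ-w n s) ⟩
        γ s * (pw (tri s) * (P (n ∔ n) * K n s)) ∎
        where s = suc j

    borwein : ∀ L → ψ (Poch 1 3 L * Poch 2 3 L)
      ≈ Σ≤ L (λ l → α l * (pw (l ∙ l) * (pw (l ∙ l) * (pw (l ∙ l) * (pw (l ∙ l) * (P (L ∔ L) * K L (l ∔ l ∔ l)))))))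
    borwein L = trans (ψ-Poch L) (trisected-product L)

-- Powers of q and geometric series in ℤ[[q]]

qpow-⊗-0 : ∀ m f → (qpow (suc m) ⊗ f) 0 ≡ 0ℤ
qpow-⊗-0 m f = ℤ.*-zeroˡ (f 0)

qpow-⊗-suc : ∀ m f n → (qpow (suc m) ⊗ f) (suc n) ≡ (qpow m ⊗ f) n
qpow-⊗-suc m f n = ≡.trans (⊗-suc (qpow (suc m)) f n) (ℤ.+-identityˡ _)

qpow-0 : qpow 0 ≗ oneS
qpow-0 zero    = ≡.refl
qpow-0 (suc n) = ≡.refl

qpow0-⊗ : ∀ f → qpow 0 ⊗ f ≗ f
qpow0-⊗ f n = ≡.trans (⊗-cong {g = f} qpow-0 (λ _ → ≡.refl) n) (⊗-identityˡ f n)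

qpow-+ : ∀ m n → qpow (m ∔ n) ≗ qpow m ⊗ qpow n
qpow-+ zero    n k       = ≡.sym (qpow0-⊗ (qpow n) k)
qpow-+ (suc m) n zero    = ≡.refl
qpow-+ (suc m) n (suc k) = ≡.trans (qpow-+ m n k) (≡.sym (qpow-⊗-suc m (qpow n) k))

qpow-⊗-+ : ∀ m f k → (qpow m ⊗ f) (m ∔ k) ≡ f k
qpow-⊗-+ zero    f k = qpow0-⊗ f k
qpow-⊗-+ (suc m) f k = ≡.trans (qpow-⊗-suc m f (m ∔ k)) (qpow-⊗-+ m f k)

qpow-⊗-< : ∀ {m k} f → k < m → (qpow m ⊗ f) k ≡ 0ℤ
qpow-⊗-< {suc m} {zero}  f _         = qpow-⊗-0 m f
qpow-⊗-< {suc m} {suc k} f (s<s k<m) = ≡.trans (qpow-⊗-suc m f k) (qpow-⊗-< f k<m)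

geomInv-+ : ∀ n k → geomInv n (suc n ∔ k) ≡ geomInv n k
geomInv-+ n k = cong (if_then 1ℤ else 0ℤ)
  (does-⇔ (mk⇔ (λ d → ∣m+n∣m⇒∣n d ∣-refl) (∣m∣n⇒∣m+n ∣-refl)) (suc n ∣? suc n ∔ k) (suc n ∣? k))

geomInv-< : ∀ n k → k < suc n → geomInv n k ≡ oneS k
geomInv-< n zero    _   = cong (if_then 1ℤ else 0ℤ) (dec-true (suc n ∣? 0) (suc n ∣0))
geomInv-< n (suc k) k<n = cong (if_then 1ℤ else 0ℤ) (dec-false (suc n ∣? suc k) (>⇒∤ k<n))

-- The coefficients of `geomInv n` have period n + 1 and begin like those of 1, so subtracting the
-- shifted series leaves 1.
geomInv-inverse : ∀ n → (oneS ⊖ qpow (suc n)) ⊗ geomInv n ≗ oneS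
geomInv-inverse n k = ≡.trans (⊗-distribʳ (geomInv n) oneS (negS (qpow (suc n))) k)
  (≡.trans (cong₂ ℤ._+_ (⊗-identityˡ (geomInv n) k) (neg-⊗ k)) (difference k))
  where
  open Algebra.Properties.Ring (CommutativeRing.ring seriesRing) using (-‿distribˡ-*)
  neg-⊗ : negS (qpow (suc n)) ⊗ geomInv n ≗ negS (qpow (suc n) ⊗ geomInv n)
  neg-⊗ k = ≡.sym (-‿distribˡ-* (qpow (suc n)) (geomInv n) k)
  difference : ∀ k → geomInv n k ℤ.- (qpow (suc n) ⊗ geomInv n) k ≡ oneS k
  difference k with offset (suc n) k
  ... | inj₁ (r , ≡.refl) = ≡.trans (cong₂ ℤ._-_ (geomInv-+ n r) (qpow-⊗-+ (suc n) (geomInv n) r)) (ℤ.+-inverseʳ (geomInv n r))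
  ... | inj₂ k<n = ≡.trans (cong₂ ℤ._-_ (geomInv-< n k k<n) (qpow-⊗-< (geomInv n) k<n)) (ℤ.+-identityʳ (oneS k))

-- Substitution of q³ for q, and trisection

-- Recursion in steps of three, instead of a divisibility test, makes the third tail of `φ f` equal
-- to `φ (tail f)` by definition.
φ : Series → Series
φ f 0                   = f 0
φ f 1                   = 0ℤ
φ f 2                   = 0ℤ
φ f (suc (suc (suc n))) = φ (tail f) n

ψ : Series → Series
ψ f n = f (n ∙ 3)

φ-cong : ∀ {f g} → f ≗ g → φ f ≗ φ g
φ-cong e 0                   = e 0
φ-cong e 1                   = ≡.refl
φ-cong e 2                   = ≡.refl
φ-cong e (suc (suc (suc n))) = φ-cong (λ k → e (suc k)) n

φ-⊕ : ∀ f g → φ (f ⊕ g) ≗ φ f ⊕ φ g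
φ-⊕ f g 0                   = ≡.refl
φ-⊕ f g 1                   = ≡.refl
φ-⊕ f g 2                   = ≡.refl
φ-⊕ f g (suc (suc (suc n))) = φ-⊕ (tail f) (tail g) n

φ-neg : ∀ f → φ (negS f) ≗ negS (φ f)
φ-neg f 0                   = ≡.refl
φ-neg f 1                   = ≡.refl
φ-neg f 2                   = ≡.refl
φ-neg f (suc (suc (suc n))) = φ-neg (tail f) n

φ-zero : φ zeroS ≗ zeroS
φ-zero 0                   = ≡.refl
φ-zero 1                   = ≡.refl
φ-zero 2                   = ≡.refl
φ-zero (suc (suc (suc n))) = φ-zero n

φ-one : φ oneS ≗ oneS
φ-one 0                   = ≡.refl
φ-one 1                   = ≡.refl
φ-one 2                   = ≡.refl
φ-one (suc (suc (suc n))) = φ-zero n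

φ-qpow-⊗ : ∀ m f → φ (qpow m ⊗ f) ≗ qpow (m ∙ 3) ⊗ φ f
φ-qpow-⊗ zero    f n = ≡.trans (φ-cong (qpow0-⊗ f) n) (≡.sym (qpow0-⊗ (φ f) n))
φ-qpow-⊗ (suc m) f 0 = ≡.refl
φ-qpow-⊗ (suc m) f 1 = ≡.sym (qpow-⊗-< {suc m ∙ 3} (φ f) (s<s z<s))
φ-qpow-⊗ (suc m) f 2 = ≡.sym (qpow-⊗-< {suc m ∙ 3} (φ f) (s<s (s<s z<s)))
φ-qpow-⊗ (suc m) f (suc (suc (suc n))) = begin
  φ (tail (qpow (suc m) ⊗ f)) n                              ≡⟨ φ-cong (qpow-⊗-suc m f) n ⟩
  φ (qpow m ⊗ f) n                                           ≡⟨ φ-qpow-⊗ m f n ⟩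
  (qpow (m ∙ 3) ⊗ φ f) n                                     ≡⟨ qpow-⊗-suc (m ∙ 3) (φ f) n ⟨
  (qpow (suc (m ∙ 3)) ⊗ φ f) (suc n)                         ≡⟨ qpow-⊗-suc (suc (m ∙ 3)) (φ f) (suc n) ⟨
  (qpow (suc (suc (m ∙ 3))) ⊗ φ f) (suc (suc n))             ≡⟨ qpow-⊗-suc (suc (suc (m ∙ 3))) (φ f) (suc (suc n)) ⟨
  (qpow (suc m ∙ 3) ⊗ φ f) (suc (suc (suc n)))               ∎
  where open ≡.≡-Reasoning

-- Three coefficients of `φ f` are peeled off at a time: the second and third are zero, and
-- `φ (tail f)` remains for the induction.
ψ-φ-⊗ : ∀ f g → ψ (φ f ⊗ g) ≗ f ⊗ ψ g
ψ-φ-⊗ f g zero    = ≡.refl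
ψ-φ-⊗ f g (suc n) = begin
  (φ f ⊗ g) (3 ∔ n ∙ 3)
    ≡⟨ ⊗-suc (φ f) g (2 ∔ n ∙ 3) ⟩
  f 0 ℤ.* g (3 ∔ n ∙ 3) ℤ.+ (tail (φ f) ⊗ g) (2 ∔ n ∙ 3)
    ≡⟨ cong (λ z → f 0 ℤ.* g (3 ∔ n ∙ 3) ℤ.+ z) (≡.trans (⊗-suc (tail (φ f)) g (1 ∔ n ∙ 3)) (≡.trans (ℤ.+-identityˡ _)
         (≡.trans (⊗-suc (tail (tail (φ f))) g (n ∙ 3)) (ℤ.+-identityˡ _)))) ⟩
  f 0 ℤ.* g (3 ∔ n ∙ 3) ℤ.+ (φ (tail f) ⊗ g) (n ∙ 3)
    ≡⟨ cong (λ z → f 0 ℤ.* g (3 ∔ n ∙ 3) ℤ.+ z) (ψ-φ-⊗ (tail f) g n) ⟩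
  f 0 ℤ.* g (3 ∔ n ∙ 3) ℤ.+ (tail f ⊗ ψ g) n
    ≡⟨ ⊗-suc f (ψ g) n ⟨
  (f ⊗ ψ g) (suc n) ∎
  where open ≡.≡-Reasoning

-- Specialisation to power series and conclusion

open CommutativeRing seriesRing

qPowers : QPowers seriesRing
qPowers = record { pw = qpow ; pw-0 = qpow-0 ; pw-+ = qpow-+ ; inv = geomInv ; inv-law = geomInv-inverse }

open QSeries seriesRing qPowers

ψ-qpow-0 : ψ (qpow 0) ≗ oneS
ψ-qpow-0 zero    = ≡.refl
ψ-qpow-0 (suc n) = ≡.refl

ψ-qpow-1 : ψ (qpow 1) ≗ zeroS
ψ-qpow-1 zero    = ≡.refl
ψ-qpow-1 (suc n) = ≡.refl

ψ-qpow-2 : ψ (qpow 2) ≗ zeroS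
ψ-qpow-2 zero    = ≡.refl
ψ-qpow-2 (suc n) = ≡.refl

ψ-qpow-3+ : ∀ n → ψ (qpow (3 ∔ n)) ≗ qpow 1 ⊗ ψ (qpow n)
ψ-qpow-3+ n zero    = ≡.refl
ψ-qpow-3+ n (suc k) = ≡.sym (≡.trans (qpow-⊗-suc 0 (ψ (qpow n)) k) (qpow0-⊗ (ψ (qpow n)) k))

open Trisection φ ψ φ-cong φ-⊕ φ-neg φ-zero φ-one φ-qpow-⊗ (λ e n → e (n ∙ 3)) (λ f g n → ≡.refl) ψ-φ-⊗
  ψ-qpow-0 ψ-qpow-1 ψ-qpow-2 ψ-qpow-3+

qPoch-Poch : ∀ a d n → qPoch a d n ≡ Poch a d n
qPoch-Poch a d zero    = ≡.refl
qPoch-Poch a d (suc n) = cong (_⊗ (oneS ⊖ qpow (a ∔ d ∙ n))) (qPoch-Poch a d n)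

qfac-P : ∀ n → qfac n ≗ P n
qfac-P n k = ≡.trans (cong (λ f → f k) (qPoch-Poch 1 1 n)) (Poch-P n k)

qfacInv-I : ∀ n → qfacInv n ≡ I n
qfacInv-I zero    = ≡.refl
qfacInv-I (suc n) = cong (_⊗ geomInv n) (qfacInv-I n)

if-dec : ∀ {A : Set} {f g h : Series} (a? : Dec A) → (A → f ≈ h) → (¬ A → g ≈ h) → (if does a? then f else g) ≈ h
if-dec (yes a) f≈h _   = f≈h a
if-dec (no ¬a) _   g≈h = g≈h ¬a

summand-Θ : ∀ L n₁ n₂ n₃ → summand L n₁ n₂ n₃ ≈ I n₁ * (I n₂ * (I n₃ * Θ L (n₁ ∔ n₂ ∔ n₃) (n₂ ∔ n₃) n₃))
summand-Θ L n₁ n₂ n₃ = if-dec (n₁ ∔ n₂ ∔ n₃ ∔ (n₂ ∔ n₃) ∔ n₃ ≤? L)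
  (Θ-inside qfac qfacInv qfac-P (λ n → reflexive (qfacInv-I n)) L n₁ n₂ n₃)
  (λ N≰L → sym (Θ-outside L n₁ n₂ n₃ (ℕ.≰⇒> N≰L)))

sumS-Σ : ∀ n {F G : ℕ → Series} → (∀ i → F i ≈ G i) → sumS n F ≈ Σ≤ n G
sumS-Σ zero    e = e 0
sumS-Σ (suc n) e = +-cong (sumS-Σ n e) (e (suc n))

theorem9p16 : (L k : ℕ) → BorweinA L k ≡ rhs L k
theorem9p16 L k = begin
  (qPoch 1 3 L ⊗ qPoch 2 3 L) (3 ∙ k)   ≡⟨ cong (qPoch 1 3 L ⊗ qPoch 2 3 L) (ℕ.*-comm 3 k) ⟩
  ψ (qPoch 1 3 L ⊗ qPoch 2 3 L) k       ≡⟨ cong₂ (λ f g → ψ (f ⊗ g) k) (qPoch-Poch 1 3 L) (qPoch-Poch 2 3 L) ⟩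
  ψ (Poch 1 3 L ⊗ Poch 2 3 L) k         ≡⟨ borwein L k ⟩
  _                                     ≡⟨ multisum L k ⟨
  _                                     ≡⟨ sumS-Σ L (λ n₁ → sumS-Σ L (λ n₂ → sumS-Σ L (summand-Θ L n₁ n₂))) k ⟨
  rhs L k                               ∎
  where open ≡.≡-Reasoning
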